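{- Let $n\ge 1$, and let $m\ge0$ and $2\le k\le n+1$ be integers. The arrangement of affine hyperplanes in $\mathbb{R}^n$ consisting of the hyperplanes $x_1-x_j=0,1,\ldots,m$ for $2\le j<k$, the hyperplanes $x_1-x_j=0,1,\ldots,m+1$ for $k\le j\le n$, and the hyperplanes $x_i-x_j=0$ and $x_i-x_j=1$ for $2\le i<j\le n$, has exactly $(n+m)^{k-2}(n+m+1)^{n-k+1}$ regions. In particular (taking $m=0$, $k=2$), the Shi arrangement in $\mathbb{R}^n$, consisting of the hyperplanes $x_i-x_j=0$ and $x_i-x_j=1$ for $1\le i<j\le n$, has $(n+1)^{n-1}$ regions.
   Context: A region of a finite arrangement of affine hyperplanes in $\mathbb{R}^n$ is a connected component of the complement of the union of its hyperplanes. -}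

module Defs where

open import Data.Fin.Base using (Fin; toℕ)
open import Data.Integer.Base using (+_)
open import Data.Nat.Base as ℕ using (ℕ; suc)
import Data.Nat.Properties as ℕ
open import Data.Product.Base using (Σ; ∃; _×_; _,_; proj₁)
open import Data.Rational.Base as ℚ using (ℚ; 0ℚ; ½; ∣_∣)
import Data.Rational.Properties as ℚ
open import Data.Rational.Solver using (module +-*-Solver)
open import Data.Sum.Base using (_⊎_)
open import Data.Vec.Functional using (Vector)
open import Function.Bundles using (Bijection)
open import Level using (0ℓ) renaming (suc to lsuc)
open import Relation.Binary.Bundles using (Setoid)
import Relation.Binary.Construct.On as On
open import Relation.Binary.PropositionalEquality using (_≡_; refl; sym; subst; cong; setoid)
open import Relation.Unary using (Pred; _∈_; _⊆_; _∩_; _∪_; Satisfiable)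
open import Relation.Unary.Relation.Binary.Equality using (≐-setoid)

-- A real is a Cauchy sequence of rationals carrying its modulus of
-- convergence; equality of reals is the relation _≃_ below.
record ℝ : Set where
  constructor mkℝ
  field
    seq    : ℕ → ℚ
    cauchy : ∀ ε → 0ℚ ℚ.< ε →
             ∃ λ N → ∀ p q → N ℕ.≤ p → N ℕ.≤ q → ∣ seq p ℚ.- seq q ∣ ℚ.< ε
open ℝ public

infix 4 _≃_ _<_ _#_

_≃_ : ℝ → ℝ → Set
x ≃ y = ∀ ε → 0ℚ ℚ.< ε → ∃ λ N → ∀ p → N ℕ.≤ p → ∣ seq x p ℚ.- seq y p ∣ ℚ.< ε

_<_ : ℝ → ℝ → Set
x < y = ∃ λ ε → 0ℚ ℚ.< ε × ∃ λ N → ∀ p → N ℕ.≤ p → ε ℚ.≤ seq y p ℚ.- seq x p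

-- Apartness, the constructive form of x ≠ y.
_#_ : ℝ → ℝ → Set
x # y = (x < y) ⊎ (y < x)

fromℚ : ℚ → ℝ
fromℚ a = mkℝ (λ _ → a) λ ε 0<ε → 0 , λ _ _ _ _ →
  subst (λ t → ∣ t ∣ ℚ.< ε) (sym (ℚ.+-inverseʳ a)) 0<ε

fromℕ : ℕ → ℝ
fromℕ c = fromℚ (+ c ℚ./ 1)

infixl 6 _-_

_-_ : ℝ → ℝ → ℝ
x - y = mkℝ (λ p → seq x p ℚ.- seq y p) cauchy′
  where
  open +-*-Solver

  halves : ∀ ε → ε ℚ.* ½ ℚ.+ ε ℚ.* ½ ≡ ε
  halves = solve 1 (λ e → e :* con ½ :+ e :* con ½ := e) refl

  regroup : ∀ a b c d → (a ℚ.- b) ℚ.- (c ℚ.- d) ≡ (a ℚ.- c) ℚ.+ ℚ.- (b ℚ.- d)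
  regroup = solve 4 (λ a b c d → (a :- b) :- (c :- d) := (a :- c) :+ :- (b :- d)) refl

  cauchy′ : ∀ ε → 0ℚ ℚ.< ε → ∃ λ N → ∀ p q → N ℕ.≤ p → N ℕ.≤ q →
            ∣ (seq x p ℚ.- seq y p) ℚ.- (seq x q ℚ.- seq y q) ∣ ℚ.< ε
  cauchy′ ε 0<ε
    with cauchy x (ε ℚ.* ½) (ℚ.*-monoˡ-<-pos ½ 0<ε)
       | cauchy y (ε ℚ.* ½) (ℚ.*-monoˡ-<-pos ½ 0<ε)
  ... | M , x-close | N , y-close = M ℕ.⊔ N , λ p q p≥ q≥ → begin-strict
    ∣ (seq x p ℚ.- seq y p) ℚ.- (seq x q ℚ.- seq y q) ∣
      ≡⟨ cong ∣_∣ (regroup (seq x p) (seq y p) (seq x q) (seq y q)) ⟩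
    ∣ (seq x p ℚ.- seq x q) ℚ.+ ℚ.- (seq y p ℚ.- seq y q) ∣
      ≤⟨ ℚ.∣p+q∣≤∣p∣+∣q∣ (seq x p ℚ.- seq x q) (ℚ.- (seq y p ℚ.- seq y q)) ⟩
    ∣ seq x p ℚ.- seq x q ∣ ℚ.+ ∣ ℚ.- (seq y p ℚ.- seq y q) ∣
      ≡⟨ cong (∣ seq x p ℚ.- seq x q ∣ ℚ.+_) (ℚ.∣-p∣≡∣p∣ (seq y p ℚ.- seq y q)) ⟩
    ∣ seq x p ℚ.- seq x q ∣ ℚ.+ ∣ seq y p ℚ.- seq y q ∣
      <⟨ ℚ.+-mono-<
           (x-close p q (ℕ.≤-trans (ℕ.m≤m⊔n M N) p≥) (ℕ.≤-trans (ℕ.m≤m⊔n M N) q≥))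
           (y-close p q (ℕ.≤-trans (ℕ.m≤n⊔m M N) p≥) (ℕ.≤-trans (ℕ.m≤n⊔m M N) q≥)) ⟩
    ε ℚ.* ½ ℚ.+ ε ℚ.* ½
      ≡⟨ halves ε ⟩
    ε ∎
    where open ℚ.≤-Reasoning

ℝ^ : ℕ → Set
ℝ^ n = Vector ℝ n

-- Open balls of the sup metric.
Ball : ∀ {n} → ℝ^ n → ℚ → Pred (ℝ^ n) 0ℓ
Ball x ε y = ∀ i → (x i - y i < fromℚ ε) × (y i - x i < fromℚ ε)

Open : ∀ {n} → Pred (ℝ^ n) 0ℓ → Set
Open U = ∀ x → x ∈ U → ∃ λ ε → 0ℚ ℚ.< ε × Ball x ε ⊆ U

-- S is not covered by two open sets that both meet S and are disjoint
-- on S, in positive form.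
Connected : ∀ {n} → Pred (ℝ^ n) 0ℓ → Set₁
Connected {n} S = (U V : Pred (ℝ^ n) 0ℓ) → Open U → Open V → S ⊆ U ∪ V →
  Satisfiable (S ∩ U) → Satisfiable (S ∩ V) → Satisfiable (S ∩ (U ∩ V))

-- Points apart from every point of S: the constructive form of ℝⁿ ∖ S.
Complement : ∀ {n} → Pred (ℝ^ n) 0ℓ → Pred (ℝ^ n) 0ℓ
Complement S x = ∀ y → y ∈ S → ∃ λ i → x i # y i

-- Connected components are the maximal nonempty connected subsets.
record IsComponent {n} (X C : Pred (ℝ^ n) 0ℓ) : Set₁ where
  field
    nonempty  : Satisfiable C
    contained : C ⊆ X
    connected : Connected C
    maximal   : ∀ D → D ⊆ X → Connected D → C ⊆ D → D ⊆ C

-- hyp i j c stands for the hyperplane xᵢ − xⱼ = c.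
record Hyperplane (n : ℕ) : Set where
  constructor hyp
  field
    i j : Fin n
    c   : ℕ

points : ∀ {n} → Hyperplane n → Pred (ℝ^ n) 0ℓ
points (hyp i j c) x = x i - x j ≃ fromℕ c

Arrangement : ℕ → Set₁
Arrangement n = Pred (Hyperplane n) 0ℓ

⋃ : ∀ {n} → Arrangement n → Pred (ℝ^ n) 0ℓ
⋃ A x = ∃ λ H → H ∈ A × x ∈ points H

IsRegion : ∀ {n} → Arrangement n → Pred (ℝ^ n) 0ℓ → Set₁
IsRegion A = IsComponent (Complement (⋃ A))

-- Regions are identified when they have the same points.
Regions : ∀ {n} → Arrangement n → Setoid (lsuc 0ℓ) 0ℓ
Regions {n} A = On.setoid {B = Σ (Pred (ℝ^ n) 0ℓ) (IsRegion A)} (≐-setoid (ℝ^ n) 0ℓ) proj₁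

HasExactlyRegions : ∀ {n} → Arrangement n → ℕ → Set₁
HasExactlyRegions A N = Bijection (setoid (Fin N)) (Regions A)

-- Coordinates are numbered from 1.
index : ∀ {n} → Fin n → ℕ
index i = suc (toℕ i)

data ShiDeformation (n m k : ℕ) : Arrangement n where
  first-<k : ∀ {i j c} → index i ≡ 1 → 2 ℕ.≤ index j → index j ℕ.< k →
             c ℕ.≤ m → ShiDeformation n m k (hyp i j c)
  first-≥k : ∀ {i j c} → index i ≡ 1 → k ℕ.≤ index j →
             c ℕ.≤ suc m → ShiDeformation n m k (hyp i j c)
  rest     : ∀ {i j c} → 2 ℕ.≤ index i → index i ℕ.< index j →
             c ≡ 0 ⊎ c ≡ 1 → ShiDeformation n m k (hyp i j c)

data Shi (n : ℕ) : Arrangement n where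
  shi : ∀ {i j c} → index i ℕ.< index j → c ≡ 0 ⊎ c ≡ 1 → Shi n (hyp i j c)

{-# OPTIONS --safe #-}

-- The family is closed under deletion and restriction.  Deleting the
-- hyperplane x₁ − x_k = m + 1 raises k by one; on that hyperplane x_k can be
-- eliminated, and the Shi hyperplanes through x_k turn into x₁ − x_i = m, m + 1
-- (i < k) and x₁ − x_j = m + 1, m + 2 (j > k), so that the restriction is the
-- arrangement with parameters n − 1, m + 1, k.  A cell of the deleted
-- arrangement is cut in two exactly when it meets the hyperplane, and the cells
-- that do are the cells of the restriction; hence the numbers of cells add up,
-- as do the numbers (n + m)^(k−2) (n + m + 1)^(n−k+1).  For k = n + 1 the
-- arrangement is that of m − 1 and k = 2; for m = 0 one goes on removing the
-- hyperplanes x₁ = x_j, each of which restricts to the Shi arrangement in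
-- n − 1 variables.
--
-- All cells are open, so they can be counted by their rational points.  A cell
-- is connected because the bisection of a segment between two of its rational
-- points converges inside it, and it is maximal because the two sides of a
-- hyperplane are open.
module Submission where

open import Defs
open import Data.Empty using (⊥; ⊥-elim)
open import Data.Fin.Base using (Fin; zero; suc; toℕ; punchIn; punchOut; fromℕ<; splitAt; join)
import Data.Fin.Properties as Fin
open import Data.Integer.Base as ℤ using (+_; +[1+_]; -[1+_])
import Data.Integer.Properties as ℤ
open import Data.Nat.Base as ℕ using (ℕ; zero; suc; _+_; _*_; _∸_; _^_; _≤_; z≤n; s≤s; z<s; s<s; s<s⁻¹)
import Data.Nat.Properties as ℕ
import Data.Nat.Solver as ℕ
open import Data.Product.Base using (∃; _×_; _,_; proj₁; proj₂)
open import Data.Rational.Base as ℚ using (ℚ; 0ℚ; 1ℚ; ½; ∣_∣; mkℚ; toℚᵘ; ↥_; ↧ₙ_)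
import Data.Rational.Properties as ℚ
open import Data.Rational.Solver using (module +-*-Solver)
open import Data.Rational.Unnormalised.Base as ℚᵘ using (mkℚᵘ; *≡*)
import Data.Rational.Unnormalised.Properties as ℚᵘ
open import Data.Sum.Base using (_⊎_; inj₁; inj₂; [_,_]′)
open import Data.Vec.Functional using (Vector; _∷_; tail; insertAt; removeAt; updateAt)
open import Data.Vec.Functional.Properties using (insertAt-lookup; insertAt-punchIn; insertAt-removeAt; updateAt-updates; updateAt-minimal)
open import Function.Base using (_∘_; const)
open import Level using (0ℓ)
open import Relation.Binary.Definitions using (tri<; tri≈; tri>)
open import Relation.Binary.PropositionalEquality
open import Relation.Nullary using (Dec; ¬_; yes; no; contradiction)
open import Relation.Unary using (Pred; _∈_; _⊆_; _∪_; _∩_; _≐_; ｛_｝; Satisfiable)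

open +-*-Solver using (solve; _:+_; _:*_; _:-_; :-_; _:=_; con)

-- Rational arithmetic

nat : ℕ → ℚ
nat c = + c ℚ./ 1

toℚᵘ-nat : ∀ c → toℚᵘ (nat c) ℚᵘ.≃ mkℚᵘ (+ c) 0
toℚᵘ-nat c = ℚ.toℚᵘ-fromℚᵘ (mkℚᵘ (+ c) 0)

nat-+ : ∀ a b → nat (a ℕ.+ b) ≡ nat a ℚ.+ nat b
nat-+ a b = ℚ.toℚᵘ-injective (begin
  toℚᵘ (nat (a ℕ.+ b))                ≈⟨ toℚᵘ-nat (a ℕ.+ b) ⟩
  mkℚᵘ (+ (a ℕ.+ b)) 0                ≈⟨ *≡* (cong (ℤ._* + 1)
    (cong₂ ℤ._+_ (sym (ℤ.*-identityʳ (+ a))) (sym (ℤ.*-identityʳ (+ b))))) ⟩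
  mkℚᵘ (+ a) 0 ℚᵘ.+ mkℚᵘ (+ b) 0      ≈⟨ ℚᵘ.+-cong (toℚᵘ-nat a) (toℚᵘ-nat b) ⟨
  toℚᵘ (nat a) ℚᵘ.+ toℚᵘ (nat b)      ≈⟨ ℚ.toℚᵘ-homo-+ (nat a) (nat b) ⟨
  toℚᵘ (nat a ℚ.+ nat b) ∎)
  where open ℚᵘ.≃-Reasoning

0≤nat : ∀ c → 0ℚ ℚ.≤ nat c
0≤nat zero    = ℚ.≤-refl
0≤nat (suc c) = ℚ.nonNegative⁻¹ (nat (suc c)) {{ℚ.normalize-nonNeg (suc c) 1}}

0<nat-suc : ∀ c → 0ℚ ℚ.< nat (suc c)
0<nat-suc c = ℚ.positive⁻¹ (nat (suc c)) {{ℚ.normalize-pos (suc c) 1}}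

-- Clearing the denominator is the source of the Archimedean property below.
p*↧p≡↥p : ∀ p → p ℚ.* nat (↧ₙ p) ≡ ↥ p ℚ./ 1
p*↧p≡↥p p@(mkℚ n d _) = ℚ.toℚᵘ-injective (begin
  toℚᵘ (p ℚ.* nat (suc d))                ≈⟨ ℚ.toℚᵘ-homo-* p (nat (suc d)) ⟩
  mkℚᵘ n d ℚᵘ.* toℚᵘ (nat (suc d))      ≈⟨ ℚᵘ.*-congˡ {mkℚᵘ n d} (toℚᵘ-nat (suc d)) ⟩
  mkℚᵘ n d ℚᵘ.* mkℚᵘ (+ suc d) 0        ≈⟨ *≡* (trans (ℤ.*-identityʳ _)
    (cong (λ t → n ℤ.* + t) (sym (ℕ.*-identityʳ (suc d))))) ⟩
  mkℚᵘ n 0                              ≈⟨ ℚ.toℚᵘ-fromℚᵘ (mkℚᵘ n 0) ⟨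
  toℚᵘ (n ℚ./ 1) ∎)
  where open ℚᵘ.≃-Reasoning

0<+ : ∀ {a b} → 0ℚ ℚ.< a → 0ℚ ℚ.< b → 0ℚ ℚ.< a ℚ.+ b
0<+ {a} {b} p q = ℚ.+-mono-< {0ℚ} {a} {0ℚ} {b} p q

0<+≤ : ∀ {a b} → 0ℚ ℚ.< a → 0ℚ ℚ.≤ b → 0ℚ ℚ.< a ℚ.+ b
0<+≤ {a} {b} p q = ℚ.+-mono-<-≤ {0ℚ} {a} {0ℚ} {b} p q

0≤+ : ∀ {a b} → 0ℚ ℚ.≤ a → 0ℚ ℚ.≤ b → 0ℚ ℚ.≤ a ℚ.+ b
0≤+ {a} {b} p q = ℚ.+-mono-≤ {0ℚ} {a} {0ℚ} {b} p q

0<* : ∀ {a b} → 0ℚ ℚ.< a → 0ℚ ℚ.< b → 0ℚ ℚ.< a ℚ.* b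
0<* {a} {b} p q = ℚ.positive⁻¹ (a ℚ.* b) {{ℚ.pos*pos⇒pos a {{ℚ.positive p}} b {{ℚ.positive q}}}}

0≤* : ∀ {a b} → 0ℚ ℚ.≤ a → 0ℚ ℚ.≤ b → 0ℚ ℚ.≤ a ℚ.* b
0≤* {a} {b} p q = ℚ.nonNegative⁻¹ (a ℚ.* b) {{ℚ.nonNeg*nonNeg⇒nonNeg a {{ℚ.nonNegative p}} b {{ℚ.nonNegative q}}}}

0<½ : 0ℚ ℚ.< ½
0<½ = ℚ.positive⁻¹ ½

b-a+a : ∀ a b → (b ℚ.- a) ℚ.+ a ≡ b
b-a+a = solve 2 (λ a b → (b :- a) :+ a := b) refl

0<diff : ∀ {a b} → a ℚ.< b → 0ℚ ℚ.< b ℚ.- a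
0<diff {a} {b} p = subst (ℚ._< b ℚ.- a) (ℚ.+-inverseʳ a) (ℚ.+-monoˡ-< (ℚ.- a) p)

0≤diff : ∀ {a b} → a ℚ.≤ b → 0ℚ ℚ.≤ b ℚ.- a
0≤diff {a} {b} p = subst (ℚ._≤ b ℚ.- a) (ℚ.+-inverseʳ a) (ℚ.+-monoˡ-≤ (ℚ.- a) p)

-- Inequalities are reduced to ring identities: a < b follows from any
-- identity b − a = d with d visibly positive.
<-by : ∀ {a b d} → 0ℚ ℚ.< d → b ℚ.- a ≡ d → a ℚ.< b
<-by {a} {b} p refl = subst₂ ℚ._<_ (ℚ.+-identityˡ a) (b-a+a a b) (ℚ.+-monoˡ-< a p)

≤-by : ∀ {a b d} → 0ℚ ℚ.≤ d → b ℚ.- a ≡ d → a ℚ.≤ b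
≤-by {a} {b} p refl = subst₂ ℚ._≤_ (ℚ.+-identityˡ a) (b-a+a a b) (ℚ.+-monoˡ-≤ a p)

neg⇒0<- : ∀ {a} → a ℚ.< 0ℚ → 0ℚ ℚ.< ℚ.- a
neg⇒0<- = ℚ.neg-antimono-<

pos⇒-<0 : ∀ {a} → 0ℚ ℚ.< a → ℚ.- a ℚ.< 0ℚ
pos⇒-<0 = ℚ.neg-antimono-<

a≤∣a∣ : ∀ a → a ℚ.≤ ∣ a ∣
a≤∣a∣ a with ℚ.≤-total 0ℚ a
... | inj₁ 0≤a = ℚ.≤-reflexive (sym (ℚ.0≤p⇒∣p∣≡p 0≤a))
... | inj₂ a≤0 = ℚ.≤-trans a≤0 (ℚ.0≤∣p∣ a)

-a≤∣a∣ : ∀ a → ℚ.- a ℚ.≤ ∣ a ∣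
-a≤∣a∣ a = subst (ℚ.- a ℚ.≤_) (ℚ.∣-p∣≡∣p∣ a) (a≤∣a∣ (ℚ.- a))

∣a∣<⁺ : ∀ {a ε} → a ℚ.< ε → ℚ.- a ℚ.< ε → ∣ a ∣ ℚ.< ε
∣a∣<⁺ {a} p q with ℚ.∣p∣≡p∨∣p∣≡-p a
... | inj₁ e = subst (ℚ._< _) (sym e) p
... | inj₂ e = subst (ℚ._< _) (sym e) q

∣a-b∣<⁻ : ∀ {a b ε} → ∣ a ℚ.- b ∣ ℚ.< ε → (a ℚ.- b ℚ.< ε) × (b ℚ.- a ℚ.< ε)
∣a-b∣<⁻ {a} {b} p = ℚ.≤-<-trans (a≤∣a∣ (a ℚ.- b)) p ,
  ℚ.≤-<-trans (subst (ℚ._≤ ∣ a ℚ.- b ∣) (solve 2 (λ a b → :- (a :- b) := b :- a) refl a b) (-a≤∣a∣ (a ℚ.- b))) p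

-- Statements true for all late indices, and the null sequence of powers of ½

Ev : (ℕ → Set) → Set
Ev P = ∃ λ N → ∀ p → N ℕ.≤ p → P p

Ev-map : ∀ {P Q : ℕ → Set} → (∀ p → P p → Q p) → Ev P → Ev Q
Ev-map f (N , h) = N , λ p N≤p → f p (h p N≤p)

Ev-× : ∀ {P Q : ℕ → Set} → Ev P → Ev Q → Ev (λ p → P p × Q p)
Ev-× (M , f) (N , g) = M ℕ.⊔ N , λ p h →
  f p (ℕ.≤-trans (ℕ.m≤m⊔n M N) h) , g p (ℕ.≤-trans (ℕ.m≤n⊔m M N) h)

Ev-Fin : ∀ {n} {P : Fin n → ℕ → Set} → (∀ i → Ev (P i)) → Ev (λ p → ∀ i → P i p)
Ev-Fin {zero}  h = 0 , λ p _ ()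
Ev-Fin {suc n} h = Ev-map (λ { p (f , g) zero → f ; p (f , g) (suc i) → g i }) (Ev-× (h zero) (Ev-Fin (h ∘ suc)))

½^ : ℕ → ℚ
½^ zero    = 1ℚ
½^ (suc p) = ½^ p ℚ.* ½

0<½^ : ∀ p → 0ℚ ℚ.< ½^ p
0<½^ zero    = ℚ.positive⁻¹ 1ℚ
0<½^ (suc p) = 0<* (0<½^ p) 0<½

-- The products decrease: passing from `p` to `p + 1` lowers them by `½^ (p + 1)` times `p`.
½^*suc≤1 : ∀ p → ½^ p ℚ.* nat (suc p) ℚ.≤ 1ℚ
½^*suc≤1 zero    = ℚ.≤-refl
½^*suc≤1 (suc p) = ℚ.≤-trans
  (≤-by (0≤* (0≤* (ℚ.<⇒≤ (0<½^ p)) (ℚ.<⇒≤ 0<½)) (0≤nat p))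
    (begin
      ½^ p ℚ.* nat (suc p) ℚ.- ½^ p ℚ.* ½ ℚ.* nat (2 ℕ.+ p)
        ≡⟨ cong₂ (λ s t → ½^ p ℚ.* s ℚ.- ½^ p ℚ.* ½ ℚ.* t) (nat-+ 1 p) (nat-+ 2 p) ⟩
      ½^ p ℚ.* (nat 1 ℚ.+ nat p) ℚ.- ½^ p ℚ.* ½ ℚ.* (nat 2 ℚ.+ nat p)
        ≡⟨ solve 2 (λ v x → v :* (con (nat 1) :+ x) :- v :* con ½ :* (con (nat 2) :+ x) := v :* con ½ :* x)
             refl (½^ p) (nat p) ⟩
      ½^ p ℚ.* ½ ℚ.* nat p ∎))
  (½^*suc≤1 p)
  where open ≡-Reasoning

-- The denominator of `ε` serves as `N`, for the product is then the numerator, a positive integer.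
1≤multiple : ∀ {ε} → 0ℚ ℚ.< ε → ∃ λ N → 1ℚ ℚ.≤ ε ℚ.* nat N
1≤multiple {p@(mkℚ +[1+ a ] d _)} _ = suc d , subst (1ℚ ℚ.≤_) (sym (p*↧p≡↥p p))
  (≤-by (0≤nat a) (trans (cong (ℚ._- 1ℚ) (nat-+ 1 a)) (solve 1 (λ x → (con 1ℚ :+ x) :- con 1ℚ := x) refl (nat a))))
1≤multiple {mkℚ (+ zero) d c} p = contradiction (ℚ.positive p) λ ()
1≤multiple {mkℚ -[1+ _ ] d c} p = contradiction (ℚ.positive p) λ ()

½^<ε : ∀ {ε} → 0ℚ ℚ.< ε → Ev (λ p → ½^ p ℚ.< ε)
½^<ε {ε} 0<ε = N , λ p N≤p → ℚ.≰⇒> λ ε≤w → ℚ.<-irrefl refl (begin-strict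
  1ℚ                              ≤⟨ 1≤εN ⟩
  ε ℚ.* nat N                       ≤⟨ ℚ.*-monoʳ-≤-nonNeg (nat N) {{ℚ.nonNegative (0≤nat N)}} ε≤w ⟩
  ½^ p ℚ.* nat N                     <⟨ <-by (0<* (0<½^ p) (0<nat-suc (p ℕ.∸ N))) (gap p N≤p) ⟩
  ½^ p ℚ.* nat (suc p)               ≤⟨ ½^*suc≤1 p ⟩
  1ℚ ∎)
  where
  open ℚ.≤-Reasoning
  N = proj₁ (1≤multiple 0<ε)
  1≤εN = proj₂ (1≤multiple 0<ε)
  gap : ∀ p → N ℕ.≤ p → ½^ p ℚ.* nat (suc p) ℚ.- ½^ p ℚ.* nat N ≡ ½^ p ℚ.* nat (suc (p ℕ.∸ N))
  gap p N≤p = begin-equality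
    ½^ p ℚ.* nat (suc p) ℚ.- ½^ p ℚ.* nat N
      ≡⟨ cong (λ t → ½^ p ℚ.* nat t ℚ.- ½^ p ℚ.* nat N) (trans (cong suc (sym (ℕ.m+[n∸m]≡n N≤p))) (sym (ℕ.+-suc N _))) ⟩
    ½^ p ℚ.* nat (N ℕ.+ suc (p ℕ.∸ N)) ℚ.- ½^ p ℚ.* nat N
      ≡⟨ cong (λ t → ½^ p ℚ.* t ℚ.- ½^ p ℚ.* nat N) (nat-+ N (suc (p ℕ.∸ N))) ⟩
    ½^ p ℚ.* (nat N ℚ.+ nat (suc (p ℕ.∸ N))) ℚ.- ½^ p ℚ.* nat N
      ≡⟨ solve 3 (λ v x y → v :* (x :+ y) :- v :* x := v :* y) refl (½^ p) (nat N) (nat (suc (p ℕ.∸ N))) ⟩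
    ½^ p ℚ.* nat (suc (p ℕ.∸ N)) ∎

-- K + 1 is used as the divisor because K itself may vanish.
½^*K<ε : ∀ {ε} K → 0ℚ ℚ.≤ K → 0ℚ ℚ.< ε → Ev (λ p → ½^ p ℚ.* K ℚ.< ε)
½^*K<ε {ε} K 0≤K 0<ε = Ev-map step (½^<ε (0<* 0<ε 0<1/K′))
  where
  K′ = 1ℚ ℚ.+ K
  0<K′ : 0ℚ ℚ.< K′
  0<K′ = 0<+≤ (ℚ.positive⁻¹ 1ℚ) 0≤K
  instance
    K′-pos : ℚ.Positive K′
    K′-pos = ℚ.positive 0<K′
    K′-nonZero : ℚ.NonZero K′
    K′-nonZero = ℚ.pos⇒nonZero K′
  0<1/K′ : 0ℚ ℚ.< ℚ.1/ K′
  0<1/K′ = ℚ.positive⁻¹ (ℚ.1/ K′) {{ℚ.1/pos⇒pos K′}}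
  step : ∀ p → ½^ p ℚ.< ε ℚ.* ℚ.1/ K′ → ½^ p ℚ.* K ℚ.< ε
  step p h = begin-strict
    ½^ p ℚ.* K              <⟨ <-by (0<½^ p) (solve 2 (λ v k → v :* (con 1ℚ :+ k) :- v :* k := v) refl (½^ p) K) ⟩
    ½^ p ℚ.* K′             <⟨ ℚ.*-monoˡ-<-pos K′ h ⟩
    ε ℚ.* ℚ.1/ K′ ℚ.* K′     ≡⟨ ℚ.*-assoc ε (ℚ.1/ K′) K′ ⟩
    ε ℚ.* (ℚ.1/ K′ ℚ.* K′)   ≡⟨ cong (ε ℚ.*_) (ℚ.*-inverseˡ K′) ⟩
    ε ℚ.* 1ℚ               ≡⟨ ℚ.*-identityʳ ε ⟩
    ε ∎
    where open ℚ.≤-Reasoning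

-- Equality of strict signs

data SameSide (a b : ℚ) : Set where
  neg : a ℚ.< 0ℚ → b ℚ.< 0ℚ → SameSide a b
  pos : 0ℚ ℚ.< a → 0ℚ ℚ.< b → SameSide a b

ss-sym : ∀ {a b} → SameSide a b → SameSide b a
ss-sym (neg p q) = neg q p
ss-sym (pos p q) = pos q p

ss-trans : ∀ {a b c} → SameSide a b → SameSide b c → SameSide a c
ss-trans (neg p q) (neg _ s) = neg p s
ss-trans (neg p q) (pos r s) = contradiction r (ℚ.<-asym q)
ss-trans (pos p q) (neg r s) = contradiction r (ℚ.<-asym q)
ss-trans (pos p q) (pos _ s) = pos p s

ss-neg : ∀ {a b} → SameSide a b → SameSide (ℚ.- a) (ℚ.- b)
ss-neg (neg p q) = pos (neg⇒0<- p) (neg⇒0<- q)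
ss-neg (pos p q) = neg (pos⇒-<0 p) (pos⇒-<0 q)

ss-neg⁻ : ∀ {a b} → SameSide (ℚ.- a) (ℚ.- b) → SameSide a b
ss-neg⁻ {a} {b} = subst₂ SameSide (solve 1 (λ a → :- :- a := a) refl a) (solve 1 (λ b → :- :- b := b) refl b) ∘ ss-neg

<0⇒ss : ∀ {a} → a ℚ.< 0ℚ → SameSide a a
<0⇒ss p = neg p p

0<⇒ss : ∀ {a} → 0ℚ ℚ.< a → SameSide a a
0<⇒ss p = pos p p

-- Either open half-line is a convex cone. This keeps segments inside cells.
ss-mix : ∀ {a b α β} → 0ℚ ℚ.< α → 0ℚ ℚ.< β → SameSide a b → SameSide a (α ℚ.* a ℚ.+ β ℚ.* b)
ss-mix 0<α 0<β (pos p q) = pos p (0<+ (0<* 0<α p) (0<* 0<β q))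
ss-mix {a} {b} {α} {β} 0<α 0<β (neg p q) = neg p (subst (ℚ._< 0ℚ)
  (solve 4 (λ a b α β → :- (α :* :- a :+ β :* :- b) := α :* a :+ β :* b) refl a b α β)
  (pos⇒-<0 (0<+ (0<* 0<α (neg⇒0<- p)) (0<* 0<β (neg⇒0<- q)))))

ss-perturb⁺ : ∀ {a} K → 0ℚ ℚ.< a → Ev (λ p → 0ℚ ℚ.< a ℚ.+ ½^ p ℚ.* K)
ss-perturb⁺ {a} K 0<a = Ev-map step (½^*K<ε ∣ K ∣ (ℚ.0≤∣p∣ K) 0<a)
  where
  step : ∀ p → ½^ p ℚ.* ∣ K ∣ ℚ.< a → 0ℚ ℚ.< a ℚ.+ ½^ p ℚ.* K
  step p h = subst (0ℚ ℚ.<_)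
    (solve 4 (λ a v k l → (a :- v :* l) :+ v :* (l :- :- k) := a :+ v :* k) refl a (½^ p) K ∣ K ∣)
    (0<+≤ (0<diff h) (0≤* (ℚ.<⇒≤ (0<½^ p)) (0≤diff (-a≤∣a∣ K))))

ss-perturb : ∀ {a} K → SameSide a a → Ev (λ p → SameSide (a ℚ.+ ½^ p ℚ.* K) a)
ss-perturb K (pos p _) = Ev-map (λ _ h → pos h p) (ss-perturb⁺ K p)
ss-perturb {a} K (neg p _) = Ev-map
  (λ n h → neg (subst (ℚ._< 0ℚ)
     (solve 3 (λ a v k → :- (:- a :+ v :* :- k) := a :+ v :* k) refl a (½^ n) K) (pos⇒-<0 h)) p)
  (ss-perturb⁺ (ℚ.- K) (neg⇒0<- p))

-- Cells and their rational points

ℚ^ : ℕ → Set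
ℚ^ n = Vector ℚ n

val : ∀ {n} → Hyperplane n → ℚ^ n → ℚ
val (hyp i j c) x = x i ℚ.- x j ℚ.- nat c

val-cong : ∀ {n} (H : Hyperplane n) {x y : ℚ^ n} → x ≗ y → val H x ≡ val H y
val-cong (hyp i j c) e = cong₂ (λ s t → s ℚ.- t ℚ.- nat c) (e i) (e j)

-- x ∼[ A ] x says that x avoids every hyperplane of A.
record _∼[_]_ {n} (x : ℚ^ n) (A : Arrangement n) (y : ℚ^ n) : Set where
  constructor mk∼
  field
    sides : ∀ H → H ∈ A → SameSide (val H x) (val H y)
open _∼[_]_

module _ {n} {A : Arrangement n} where
  ∼-sym : ∀ {x y} → x ∼[ A ] y → y ∼[ A ] x
  ∼-sym p = mk∼ λ H m → ss-sym (sides p H m)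

  ∼-trans : ∀ {x y z} → x ∼[ A ] y → y ∼[ A ] z → x ∼[ A ] z
  ∼-trans p q = mk∼ λ H m → ss-trans (sides p H m) (sides q H m)

  ∼-reflˡ : ∀ {x y} → x ∼[ A ] y → x ∼[ A ] x
  ∼-reflˡ p = ∼-trans p (∼-sym p)

  ∼-respˡ : ∀ {x y z} → x ≗ y → x ∼[ A ] z → y ∼[ A ] z
  ∼-respˡ e p = mk∼ λ H m → subst (λ t → SameSide t _) (val-cong H e) (sides p H m)

-- Finiteness of A, in the only form needed.
Uniform : ∀ {n} → Arrangement n → Set₁
Uniform {n} A = (P : ℕ → Hyperplane n → Set) →
  (∀ H → H ∈ A → Ev (λ p → P p H)) → Ev (λ p → ∀ H → H ∈ A → P p H)

-- A transversal of the classes of `∼` among the rational points off `A`, so that `N` is the number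
-- of cells. Finiteness is bundled in because the recursion has to carry it along.
record Reps {n} (A : Arrangement n) (N : ℕ) : Set₁ where
  field
    uniform : Uniform A
    rep     : Fin N → ℚ^ n
    off     : ∀ i → rep i ∼[ A ] rep i
    inj     : ∀ i j → rep i ∼[ A ] rep j → i ≡ j
    find    : ∀ x → x ∼[ A ] x → ∃ λ i → x ∼[ A ] rep i

Uniform-resp : ∀ {n} {A B : Arrangement n} → A ≐ B → Uniform A → Uniform B
Uniform-resp (A⊆B , B⊆A) u P h = Ev-map (λ p f H m → f H (B⊆A m)) (u P (λ H m → h H (A⊆B m)))

∼-⊆ : ∀ {n} {A B : Arrangement n} {x y} → A ⊆ B → x ∼[ B ] y → x ∼[ A ] y
∼-⊆ A⊆B e = mk∼ λ H m → sides e H (A⊆B m)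

Reps-resp : ∀ {n} {A B : Arrangement n} {N} → A ≐ B → Reps A N → Reps B N
Reps-resp {A = A} {B} (A⊆B , B⊆A) R = record
  { uniform = Uniform-resp {A = A} {B} (A⊆B , B⊆A) uniform
  ; rep     = rep
  ; off     = λ i → ∼-⊆ B⊆A (off i)
  ; inj     = λ i j e → inj i j (∼-⊆ A⊆B e)
  ; find    = λ x o → let i , e = find x (∼-⊆ A⊆B o) in i , ∼-⊆ B⊆A e
  }
  where open Reps R

-- Deletion and restriction

val-mix : ∀ {n} (H : Hyperplane n) (x y : ℚ^ n) α β → α ℚ.+ β ≡ 1ℚ →
          val H (λ l → α ℚ.* x l ℚ.+ β ℚ.* y l) ≡ α ℚ.* val H x ℚ.+ β ℚ.* val H y
val-mix (hyp i j c) x y α β e = begin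
  (α ℚ.* x i ℚ.+ β ℚ.* y i) ℚ.- (α ℚ.* x j ℚ.+ β ℚ.* y j) ℚ.- nat c
    -- `val H` is affine, not linear: the constant is distributed by means of `α + β = 1`.
    ≡⟨ cong (λ t → (α ℚ.* x i ℚ.+ β ℚ.* y i) ℚ.- (α ℚ.* x j ℚ.+ β ℚ.* y j) ℚ.- t)
         (trans (sym (ℚ.*-identityˡ (nat c))) (cong (ℚ._* nat c) (sym e))) ⟩
  (α ℚ.* x i ℚ.+ β ℚ.* y i) ℚ.- (α ℚ.* x j ℚ.+ β ℚ.* y j) ℚ.- (α ℚ.+ β) ℚ.* nat c
    ≡⟨ solve 7 (λ a b xi yi xj yj c →
         (a :* xi :+ b :* yi) :- (a :* xj :+ b :* yj) :- (a :+ b) :* c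
         := a :* (xi :- xj :- c) :+ b :* (yi :- yj :- c)) refl α β (x i) (y i) (x j) (y j) (nat c) ⟩
  α ℚ.* (x i ℚ.- x j ℚ.- nat c) ℚ.+ β ℚ.* (y i ℚ.- y j ℚ.- nat c) ∎
  where open ≡-Reasoning

-- On the segment from `x` to `y` the affine function `val H` vanishes at the point with weights
-- `g / (g − f)` and `−f / (g − f)`. Both are positive, so the point stays in the cell.
crossing : ∀ {n} {A : Arrangement n} (H : Hyperplane n) {x y} → x ∼[ A ] y →
           val H x ℚ.< 0ℚ → 0ℚ ℚ.< val H y → ∃ λ z → z ∼[ A ] x × val H z ≡ 0ℚ
crossing {A = A} H {x} {y} x∼y f<0 0<g =
  z , (mk∼ λ K m → ss-sym (subst (SameSide (val K x)) (sym (val-mix K x y α β α+β≡1)) (ss-mix 0<α 0<β (sides x∼y K m)))) ,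
  trans (val-mix H x y α β α+β≡1) (cancel f g (ℚ.1/ D))
  where
  cancel : ∀ f g d → g ℚ.* d ℚ.* f ℚ.+ (ℚ.- f) ℚ.* d ℚ.* g ≡ 0ℚ
  cancel = solve 3 (λ f g d → g :* d :* f :+ (:- f) :* d :* g := con 0ℚ) refl
  f = val H x
  g = val H y
  D = g ℚ.- f
  0<D : 0ℚ ℚ.< D
  0<D = 0<+ 0<g (neg⇒0<- f<0)
  instance
    D-pos : ℚ.Positive D
    D-pos = ℚ.positive 0<D
    D-nonZero : ℚ.NonZero D
    D-nonZero = ℚ.pos⇒nonZero D
  0<1/D : 0ℚ ℚ.< ℚ.1/ D
  0<1/D = ℚ.positive⁻¹ (ℚ.1/ D) {{ℚ.1/pos⇒pos D}}
  α = g ℚ.* ℚ.1/ D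
  β = (ℚ.- f) ℚ.* ℚ.1/ D
  z = λ l → α ℚ.* x l ℚ.+ β ℚ.* y l
  0<α = 0<* 0<g 0<1/D
  0<β = 0<* (neg⇒0<- f<0) 0<1/D
  α+β≡1 : α ℚ.+ β ≡ 1ℚ
  α+β≡1 = trans (sym (ℚ.*-distribʳ-+ (ℚ.1/ D) g (ℚ.- f))) (ℚ.*-inverseʳ D)

-- Each hyperplane tolerates all sufficiently small shifts, and uniformity yields one shift
-- tolerated by all of them.
perturb : ∀ {n} {A : Arrangement n} → Uniform A → (x v : ℚ^ n) → x ∼[ A ] x →
          ∃ λ p → (λ l → x l ℚ.+ ½^ p ℚ.* v l) ∼[ A ] x
perturb {A = A} u x v o = let N , h = u P each in N , mk∼ (h N ℕ.≤-refl)
  where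
  P = λ p H → SameSide (val H (λ l → x l ℚ.+ ½^ p ℚ.* v l)) (val H x)
  each : ∀ H → H ∈ A → Ev (λ p → P p H)
  each H@(hyp i j c) m = Ev-map
    (λ p → subst (λ t → SameSide t (val H x))
      (solve 6 (λ xi xj vi vj k c → (xi :- xj :- c) :+ k :* (vi :- vj)
         := (xi :+ k :* vi) :- (xj :+ k :* vj) :- c) refl (x i) (x j) (v i) (v j) (½^ p) (nat c)))
    (ss-perturb (v i ℚ.- v j) (sides o H m))

-- Elimination of a coordinate may produce the equation of a hyperplane with the opposite sign. This
-- exchanges its sides but not the relation of lying on the same side.
_≈±_ : ∀ {q} → (f g : ℚ^ q → ℚ) → Set
f ≈± g = (∀ y → f y ≡ g y) ⊎ (∀ y → f y ≡ ℚ.- g y)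

ss-≈± : ∀ {q} {f g : ℚ^ q → ℚ} → f ≈± g → ∀ {y y′} → SameSide (g y) (g y′) → SameSide (f y) (f y′)
ss-≈± (inj₁ e) s = subst₂ SameSide (sym (e _)) (sym (e _)) s
ss-≈± (inj₂ e) s = subst₂ SameSide (sym (e _)) (sym (e _)) (ss-neg s)

ss-≈±⁻ : ∀ {q} {f g : ℚ^ q → ℚ} → f ≈± g → ∀ {y y′} → SameSide (f y) (f y′) → SameSide (g y) (g y′)
ss-≈±⁻ (inj₁ e) s = subst₂ SameSide (e _) (e _) s
ss-≈±⁻ (inj₂ e) s = ss-neg⁻ (subst₂ SameSide (e _) (e _) s)

-- H is parametrised by embed.  A hyperplane parallel to H does not meet it,
-- whence the second alternative of restrict.
record IsRestriction {n q} (A : Arrangement n) (H : Hyperplane n) (B : Arrangement q) : Set where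
  field
    embed         : ℚ^ q → ℚ^ n
    project       : ℚ^ n → ℚ^ q
    embed-on      : ∀ y → val H (embed y) ≡ 0ℚ
    embed-project : ∀ x → val H x ≡ 0ℚ → embed (project x) ≗ x
    restrict      : ∀ K → K ∈ A → (∃ λ L → L ∈ B × (val K ∘ embed) ≈± val L) ⊎ (∀ y → 0ℚ ℚ.< val K (embed y))
    extend        : ∀ L → L ∈ B → ∃ λ K → K ∈ A × (val K ∘ embed) ≈± val L

  embed-∼ : ∀ {y y′} → y ∼[ B ] y′ → embed y ∼[ A ] embed y′
  embed-∼ {y} {y′} e = mk∼ λ K m →
    [ (λ (L , m′ , s) → ss-≈± s (sides e L m′)) , (λ 0< → pos (0< y) (0< y′)) ]′ (restrict K m)

  -- Every hyperplane of `B` is the trace of one of `A`, so different cells of `B` lie in different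
  -- cells of `A`.
  embed-∼⁻ : ∀ {y y′} → embed y ∼[ A ] embed y′ → y ∼[ B ] y′
  embed-∼⁻ e = mk∼ λ L m → let K , m′ , s = extend L m in ss-≈±⁻ s (sides e K m′)

Uniform-∪ : ∀ {n} {A : Arrangement n} H → Uniform A → Uniform (A ∪ ｛ H ｝)
Uniform-∪ H u P h = Ev-map (λ { p (f , g) K (inj₁ m) → f K m ; p (f , g) K (inj₂ refl) → g })
  (Ev-× (u P (λ K m → h K (inj₁ m))) (h H (inj₂ refl)))

module _ {n q} {A : Arrangement n} {H : Hyperplane n} {B : Arrangement q} {M N : ℕ}
         (v : ℚ^ n) (transversal : v (Hyperplane.i H) ℚ.- v (Hyperplane.j H) ≡ 1ℚ)
         (res : IsRestriction A H B) (RA : Reps A M) (RB : Reps B N) where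
  private
    open IsRestriction res
    module A = Reps RA
    module B = Reps RB

    A⁺ : Arrangement n
    A⁺ = A ∪ ｛ H ｝

    trace : Fin N → ℚ^ n
    trace s = embed (B.rep s)

    trace-off : ∀ s → trace s ∼[ A ] trace s
    trace-off s = embed-∼ (B.off s)

    cell : Fin N → Fin M
    cell s = proj₁ (A.find (trace s) (trace-off s))

    trace∼cell : ∀ s → trace s ∼[ A ] A.rep (cell s)
    trace∼cell s = proj₂ (A.find (trace s) (trace-off s))

    -- Expressed through representatives, the condition is decidable by a finite search; `meets`
    -- shows that it covers all rational points of the cell on `H`.
    Meets : Fin M → Set
    Meets r = ∃ λ s → cell s ≡ r

    -- The projection of `x` lies in some cell of `B`, and the trace of its representative shares
    -- the cell of `x` in `A`.
    meets : ∀ {x} r → x ∼[ A ] A.rep r → val H x ≡ 0ℚ → Meets r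
    meets {x} r x∼r on = s , A.inj (cell s) r (∼-trans (∼-sym (trace∼cell s)) (∼-trans (∼-sym x∼s) x∼r))
      where
      y = project x
      ey≗x = embed-project x on
      y-off : y ∼[ B ] y
      y-off = embed-∼⁻ (∼-respˡ (sym ∘ ey≗x) (∼-sym (∼-respˡ (sym ∘ ey≗x) (∼-reflˡ x∼r))))
      s = proj₁ (B.find y y-off)
      x∼s : x ∼[ A ] trace s
      x∼s = ∼-respˡ ey≗x (embed-∼ (proj₂ (B.find y y-off)))

    val-shift : ∀ y p (u : ℚ^ n) → val H (embed y) ≡ 0ℚ →
                val H (λ l → embed y l ℚ.+ ½^ p ℚ.* u l) ≡ ½^ p ℚ.* (u (Hyperplane.i H) ℚ.- u (Hyperplane.j H))
    val-shift y p u e = begin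
      (embed y i ℚ.+ ½^ p ℚ.* u i) ℚ.- (embed y j ℚ.+ ½^ p ℚ.* u j) ℚ.- nat c
        ≡⟨ solve 6 (λ xi xj vi vj k c → (xi :+ k :* vi) :- (xj :+ k :* vj) :- c
             := (xi :- xj :- c) :+ k :* (vi :- vj)) refl (embed y i) (embed y j) (u i) (u j) (½^ p) (nat c) ⟩
      val H (embed y) ℚ.+ ½^ p ℚ.* (u i ℚ.- u j)
        ≡⟨ cong (ℚ._+ ½^ p ℚ.* (u i ℚ.- u j)) e ⟩
      0ℚ ℚ.+ ½^ p ℚ.* (u i ℚ.- u j)
        ≡⟨ ℚ.+-identityˡ _ ⟩
      ½^ p ℚ.* (u i ℚ.- u j) ∎
      where
      open ≡-Reasoning
      open Hyperplane H

    -- The trace is pushed off `H` to either side, so little that it does not leave its cell of `A`.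
    above below : Fin N → ℚ^ n
    above s l = trace s l ℚ.+ ½^ (proj₁ (perturb A.uniform (trace s) v (trace-off s))) ℚ.* v l
    below s l = trace s l ℚ.+ ½^ (proj₁ (perturb A.uniform (trace s) (ℚ.-_ ∘ v) (trace-off s))) ℚ.* ℚ.- v l

    above∼ : ∀ s → above s ∼[ A ] trace s
    above∼ s = proj₂ (perturb A.uniform (trace s) v (trace-off s))

    below∼ : ∀ s → below s ∼[ A ] trace s
    below∼ s = proj₂ (perturb A.uniform (trace s) (ℚ.-_ ∘ v) (trace-off s))

    above-pos : ∀ s → 0ℚ ℚ.< val H (above s)
    above-pos s = subst (0ℚ ℚ.<_)
      (sym (trans (val-shift (B.rep s) p v (embed-on _)) (trans (cong (½^ p ℚ.*_) transversal) (ℚ.*-identityʳ _))))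
      (0<½^ p)
      where p = proj₁ (perturb A.uniform (trace s) v (trace-off s))

    below-neg : ∀ s → val H (below s) ℚ.< 0ℚ
    below-neg s = subst (ℚ._< 0ℚ)
      (sym (trans (val-shift (B.rep s) p (ℚ.-_ ∘ v) (embed-on _))
        (trans (solve 3 (λ k a b → k :* (:- a :- :- b) := :- (k :* (a :- b))) refl
                 (½^ p) (v (Hyperplane.i H)) (v (Hyperplane.j H)))
          (cong ℚ.-_ (trans (cong (½^ p ℚ.*_) transversal) (ℚ.*-identityʳ _))))))
      (pos⇒-<0 (0<½^ p))
      where p = proj₁ (perturb A.uniform (trace s) (ℚ.-_ ∘ v) (trace-off s))

    meets? : ∀ r → Dec (Meets r)
    meets? r = Fin.any? (λ s → cell s Fin.≟ r)

    -- Of a cell cut by `H` the negative half is represented here, the positive half by `above`. The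
    -- decision is an argument so that the properties follow by matching on it.
    choose : ∀ r → Dec (Meets r) → ℚ^ n
    choose r (yes (s , _)) = below s
    choose r (no _)        = A.rep r

    choose∼ : ∀ r d → choose r d ∼[ A ] A.rep r
    choose∼ r (yes (s , refl)) = ∼-trans (below∼ s) (trace∼cell s)
    choose∼ r (no _)           = A.off r

    choose-neg : ∀ r d → Meets r → val H (choose r d) ℚ.< 0ℚ
    choose-neg r (yes (s , _)) _ = below-neg s
    choose-neg r (no ¬m)       m = contradiction m ¬m

    side : ∀ r x → x ∼[ A ] A.rep r → ¬ Meets r → SameSide (val H x) (val H x)
    side r x e ¬m with ℚ.<-cmp (val H x) 0ℚ
    ... | tri< p _ _ = <0⇒ss p
    ... | tri≈ _ p _ = contradiction (meets r e p) ¬m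
    ... | tri> _ _ p = 0<⇒ss p

    choose-off : ∀ r d → SameSide (val H (choose r d)) (val H (choose r d))
    choose-off r (yes (s , _)) = <0⇒ss (below-neg s)
    choose-off r (no ¬m)       = side r (A.rep r) (A.off r) ¬m

    base : Fin M → ℚ^ n
    base r = choose r (meets? r)

    base∼ : ∀ r → base r ∼[ A ] A.rep r
    base∼ r = choose∼ r (meets? r)

    base-neg : ∀ r → Meets r → val H (base r) ℚ.< 0ℚ
    base-neg r = choose-neg r (meets? r)

    -- Opposite sides of H within a cell missing H are excluded by
    -- crossing H along a segment.
    same-side : ∀ r x y → x ∼[ A ] A.rep r → y ∼[ A ] A.rep r → ¬ Meets r →
                SameSide (val H x) (val H y)
    same-side r x y x∼ y∼ ¬m with side r x x∼ ¬m | side r y y∼ ¬m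
    ... | neg p _ | neg q _ = neg p q
    ... | pos p _ | pos q _ = pos p q
    ... | neg p _ | pos q _ = let z , z∼x , on = crossing H (∼-trans x∼ (∼-sym y∼)) p q in
                              contradiction (meets r (∼-trans z∼x x∼) on) ¬m
    ... | pos p _ | neg q _ = let z , z∼y , on = crossing H (∼-trans y∼ (∼-sym x∼)) q p in
                              contradiction (meets r (∼-trans z∼y y∼) on) ¬m

    rep′ : Fin M ⊎ Fin N → ℚ^ n
    rep′ = [ base , above ]′

    _&_ : ∀ {x y} → x ∼[ A ] y → SameSide (val H x) (val H y) → x ∼[ A⁺ ] y
    e & s = mk∼ λ { K (inj₁ m) → sides e K m ; K (inj₂ refl) → s }

    left : ∀ {x y} → x ∼[ A⁺ ] y → x ∼[ A ] y
    left = ∼-⊆ inj₁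

    right : ∀ {x y} → x ∼[ A⁺ ] y → SameSide (val H x) (val H y)
    right e = sides e H (inj₂ refl)

    off′ : ∀ a → rep′ a ∼[ A⁺ ] rep′ a
    off′ (inj₁ r) = ∼-reflˡ (base∼ r) & choose-off r (meets? r)
    off′ (inj₂ s) = ∼-reflˡ (above∼ s) & 0<⇒ss (above-pos s)

    base≁above : ∀ r s → ¬ (base r ∼[ A⁺ ] above s)
    base≁above r s e = opposite (right e)
      where
      r≡cell : r ≡ cell s
      r≡cell = A.inj r (cell s)
        (∼-trans (∼-sym (base∼ r)) (∼-trans (left e) (∼-trans (above∼ s) (trace∼cell s))))
      opposite : ¬ SameSide (val H (base r)) (val H (above s))
      opposite (neg _ q) = ℚ.<-asym q (above-pos s)
      opposite (pos p _) = ℚ.<-asym p (base-neg r (s , sym r≡cell))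

    inj′ : ∀ a b → rep′ a ∼[ A⁺ ] rep′ b → a ≡ b
    inj′ (inj₁ r) (inj₁ r′) e = cong inj₁ (A.inj r r′ (∼-trans (∼-sym (base∼ r)) (∼-trans (left e) (base∼ r′))))
    inj′ (inj₁ r) (inj₂ s)  e = contradiction e (base≁above r s)
    inj′ (inj₂ s) (inj₁ r)  e = contradiction (∼-sym e) (base≁above r s)
    -- Two points above `H` in the same cell of `A` have their traces in that cell, hence in one
    -- cell of `B`.
    inj′ (inj₂ s) (inj₂ s′) e = cong inj₂ (B.inj s s′
      (embed-∼⁻ (∼-trans (∼-sym (above∼ s)) (∼-trans (left e) (above∼ s′)))))

    find′ : ∀ x → x ∼[ A⁺ ] x → ∃ λ a → x ∼[ A⁺ ] rep′ a
    find′ x o = locate (meets? r) (right o)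
      where
      r = proj₁ (A.find x (left o))
      x∼r = proj₂ (A.find x (left o))
      x∼base = ∼-trans x∼r (∼-sym (base∼ r))
      locate : Dec (Meets r) → SameSide (val H x) (val H x) → ∃ λ a → x ∼[ A⁺ ] rep′ a
      locate (no ¬m)       _         = inj₁ r , (x∼base & same-side r x (base r) x∼r (base∼ r) ¬m)
      locate (yes m)       (neg p _) = inj₁ r , (x∼base & neg p (base-neg r m))
      locate (yes (s , e)) (pos p _) = inj₂ s ,
        (∼-trans x∼r (subst (λ t → A.rep t ∼[ A ] above s) e (∼-sym (∼-trans (above∼ s) (trace∼cell s))))
          & pos p (above-pos s))

  -- A cell of A is cut in two by H exactly when it meets H, and the cells
  -- of A meeting H are in bijection with the cells of B.
  deletion-restriction : Reps (A ∪ ｛ H ｝) (M ℕ.+ N)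
  deletion-restriction = record
    { uniform = Uniform-∪ H A.uniform
    ; rep     = rep′ ∘ splitAt M
    ; off     = off′ ∘ splitAt M
    ; inj     = λ i j e → trans (sym (Fin.join-splitAt M N i))
                  (trans (cong (join M N) (inj′ (splitAt M i) (splitAt M j) e)) (Fin.join-splitAt M N j))
    ; find    = λ x o → let a , e = find′ x o in
                  join M N a , subst (λ b → x ∼[ A⁺ ] rep′ b) (sym (Fin.splitAt-join M N a)) e
    }

-- The recursion for the deformed arrangements

-- The arrangement of the theorem in ℝ^(n+1), with m = M − 1 and the
-- threshold k shifted by 2.  Allowing M = 0 makes the whole recursion start
-- from the Shi arrangement in one dimension less.
data Deform (n M k : ℕ) : Arrangement (suc n) where
  low   : ∀ {j c} → toℕ j ℕ.< k → c ℕ.< M → Deform n M k (hyp zero (suc j) c)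
  high  : ∀ {j c} → k ℕ.≤ toℕ j → c ℕ.≤ M → Deform n M k (hyp zero (suc j) c)
  later : ∀ {i j c} → Shi n (hyp i j c) → Deform n M k (hyp (suc i) (suc j) c)

-- Renumbering of the coordinates when one is removed

toℕ-punchIn : ∀ {n} (i : Fin (suc n)) j →
  (toℕ j ℕ.< toℕ i × toℕ (punchIn i j) ≡ toℕ j) ⊎ (toℕ i ℕ.≤ toℕ j × toℕ (punchIn i j) ≡ suc (toℕ j))
toℕ-punchIn zero    j       = inj₂ (z≤n , refl)
toℕ-punchIn (suc i) zero    = inj₁ (z<s , refl)
toℕ-punchIn (suc i) (suc j) with toℕ-punchIn i j
... | inj₁ (p , e) = inj₁ (s<s p , cong suc e)
... | inj₂ (p , e) = inj₂ (s≤s p , cong suc e)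

data PunchView {n} (i : Fin (suc n)) : Fin (suc n) → Set where
  hole    : PunchView i i
  punched : ∀ j → PunchView i (punchIn i j)

punchView : ∀ {n} (i l : Fin (suc n)) → PunchView i l
punchView i l with i Fin.≟ l
... | yes refl = hole
... | no i≢l   = subst (PunchView i) (Fin.punchIn-punchOut i≢l) (punched (punchOut i≢l))

punchIn-mono-< : ∀ {n} (i : Fin (suc n)) {j l} → toℕ j ℕ.< toℕ l → toℕ (punchIn i j) ℕ.< toℕ (punchIn i l)
punchIn-mono-< i {j} {l} p with toℕ-punchIn i j | toℕ-punchIn i l
... | inj₁ (_ , e) | inj₁ (_ , f) = subst₂ ℕ._<_ (sym e) (sym f) p
... | inj₁ (_ , e) | inj₂ (_ , f) = subst₂ ℕ._<_ (sym e) (sym f) (ℕ.m<n⇒m<1+n p)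
... | inj₂ (q , e) | inj₁ (r , f) = contradiction (ℕ.<-trans (ℕ.≤-<-trans q p) r) (ℕ.<-irrefl refl)
... | inj₂ (_ , e) | inj₂ (_ , f) = subst₂ ℕ._<_ (sym e) (sym f) (s<s p)

punchIn-cancel-< : ∀ {n} (i : Fin (suc n)) {j l} → toℕ (punchIn i j) ℕ.< toℕ (punchIn i l) → toℕ j ℕ.< toℕ l
punchIn-cancel-< i {j} {l} p with ℕ.<-cmp (toℕ j) (toℕ l)
... | tri< q _ _ = q
... | tri≈ _ q _ = contradiction p (ℕ.<-irrefl (cong (toℕ ∘ punchIn i) (Fin.toℕ-injective q)))
... | tri> _ _ q = contradiction p (ℕ.<-asym (punchIn-mono-< i q))

punchIn<⇒ : ∀ {n} (i : Fin (suc n)) {j} → toℕ (punchIn i j) ℕ.≤ toℕ i → toℕ j ℕ.< toℕ i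
punchIn<⇒ i {j} p with toℕ-punchIn i j
... | inj₁ (q , _) = q
... | inj₂ (q , e) = contradiction (subst (ℕ._≤ toℕ i) e p) (ℕ.≤⇒≯ q)

punchIn>⇒ : ∀ {n} (i : Fin (suc n)) {j} → toℕ i ℕ.< toℕ (punchIn i j) → toℕ i ℕ.≤ toℕ j
punchIn>⇒ i {j} p with toℕ-punchIn i j
... | inj₁ (q , e) = contradiction (subst (toℕ i ℕ.<_) e p) (ℕ.<⇒≯ q)
... | inj₂ (q , _) = q

<⇒punchIn< : ∀ {n} (i : Fin (suc n)) {j} → toℕ j ℕ.< toℕ i → toℕ (punchIn i j) ℕ.< toℕ i
<⇒punchIn< i {j} p with toℕ-punchIn i j
... | inj₁ (_ , e) = subst (ℕ._< toℕ i) (sym e) p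
... | inj₂ (q , _) = contradiction q (ℕ.<⇒≱ p)

≤⇒<punchIn : ∀ {n} (i : Fin (suc n)) {j} → toℕ i ℕ.≤ toℕ j → toℕ i ℕ.< toℕ (punchIn i j)
≤⇒<punchIn i {j} p with toℕ-punchIn i j
... | inj₁ (q , _) = contradiction p (ℕ.<⇒≱ q)
... | inj₂ (_ , e) = subst (toℕ i ℕ.<_) (sym e) (s≤s p)

-- Deletion and restriction inside the family

Deform-insert : ∀ n M (κ : Fin n) →
  (Deform n M (suc (toℕ κ)) ∪ ｛ hyp zero (suc κ) M ｝) ≐ Deform n M (toℕ κ)
Deform-insert n M κ = to , from
  where
  to : (Deform n M (suc (toℕ κ)) ∪ ｛ hyp zero (suc κ) M ｝) ⊆ Deform n M (toℕ κ)
  to (inj₁ (low {j} j<1+κ c<M)) with ℕ.m≤n⇒m<n∨m≡n (ℕ.≤-pred j<1+κ)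
  ... | inj₁ j<κ = low j<κ c<M
  ... | inj₂ j≡κ = high (ℕ.≤-reflexive (sym j≡κ)) (ℕ.<⇒≤ c<M)
  to (inj₁ (high κ<j c≤M)) = high (ℕ.<⇒≤ κ<j) c≤M
  to (inj₁ (later s))      = later s
  to (inj₂ refl)           = high ℕ.≤-refl ℕ.≤-refl
  from : Deform n M (toℕ κ) ⊆ (Deform n M (suc (toℕ κ)) ∪ ｛ hyp zero (suc κ) M ｝)
  from (low j<κ c<M) = inj₁ (low (ℕ.m<n⇒m<1+n j<κ) c<M)
  from (later s)     = inj₁ (later s)
  from (high {j} κ≤j c≤M) with ℕ.m≤n⇒m<n∨m≡n κ≤j
  ... | inj₁ κ<j = inj₁ (high κ<j c≤M)
  -- Raising the threshold turns `c ≤ M` into `c < M` at the index `κ` only, so the one hyperplane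
  -- lost is that with `c = M`.
  ... | inj₂ κ≡j with ℕ.m≤n⇒m<n∨m≡n c≤M
  ...   | inj₁ c<M  = inj₁ (low (s≤s (ℕ.≤-reflexive (sym κ≡j))) c<M)
  ...   | inj₂ refl = inj₂ (cong (λ t → hyp zero (suc t) M) (Fin.toℕ-injective κ≡j))

-- On the hyperplane x₀ − x_κ = M the coordinate x_κ is eliminated; a Shi
-- hyperplane through x_κ becomes one through x₀, shifted by M.
Deform-restrict : ∀ n M (κ : Fin (suc n)) →
  IsRestriction (Deform (suc n) (suc M) (suc (toℕ κ))) (hyp zero (suc κ) (suc M)) (Deform n (suc (suc M)) (toℕ κ))
Deform-restrict n M κ = record
  { embed         = e
  ; project       = λ x → x zero ∷ removeAt (tail x) κ
  ; embed-on      = λ y → trans (cong (λ t → y zero ℚ.- t ℚ.- nat M₁) (e-hole y))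
                      (solve 2 (λ a m → a :- (a :- m) :- m := con 0ℚ) refl (y zero) (nat M₁))
  ; embed-project = embed-project
  ; restrict      = λ K → restrict K
  ; extend        = λ K → extend K
  }
  where
  M₁ = suc M

  e : ℚ^ (suc n) → ℚ^ (suc (suc n))
  e y = y zero ∷ insertAt (tail y) κ (y zero ℚ.- nat M₁)

  e-hole : ∀ y → e y (suc κ) ≡ y zero ℚ.- nat M₁
  e-hole y = insertAt-lookup (tail y) κ (y zero ℚ.- nat M₁)

  e-punched : ∀ y j → e y (suc (punchIn κ j)) ≡ y (suc j)
  e-punched y j = insertAt-punchIn (tail y) κ (y zero ℚ.- nat M₁) j

  embed-project : ∀ x → val (hyp zero (suc κ) M₁) x ≡ 0ℚ → e (x zero ∷ removeAt (tail x) κ) ≗ x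
  embed-project x on zero    = refl
  embed-project x on (suc l) = trans (cong (λ t → insertAt (removeAt (tail x) κ) κ t l) x₀-M≡xκ)
                                     (insertAt-removeAt (tail x) κ l)
    where
    x₀-M≡xκ : x zero ℚ.- nat M₁ ≡ x (suc κ)
    x₀-M≡xκ = trans (solve 3 (λ a b m → a :- m := (a :- b :- m) :+ b) refl (x zero) (x (suc κ)) (nat M₁))
                    (trans (cong (ℚ._+ x (suc κ)) on) (ℚ.+-identityˡ _))

  through-first : ∀ j c y → val (hyp zero (suc (punchIn κ j)) c) (e y) ≡ val (hyp zero (suc j) c) y
  through-first j c y = cong (λ t → y zero ℚ.- t ℚ.- nat c) (e-punched y j)

  through-neither : ∀ i j c y → val (hyp (suc (punchIn κ i)) (suc (punchIn κ j)) c) (e y) ≡ val (hyp (suc i) (suc j) c) y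
  through-neither i j c y = cong₂ (λ s t → s ℚ.- t ℚ.- nat c) (e-punched y i) (e-punched y j)

  hole-first : ∀ j c y → val (hyp (suc κ) (suc (punchIn κ j)) c) (e y) ≡ val (hyp zero (suc j) (M₁ ℕ.+ c)) y
  hole-first j c y = trans (cong₂ (λ s t → s ℚ.- t ℚ.- nat c) (e-hole y) (e-punched y j))
    (trans (solve 4 (λ a b m c → (a :- m) :- b :- c := a :- b :- (m :+ c)) refl (y zero) (y (suc j)) (nat M₁) (nat c))
      (cong (λ t → y zero ℚ.- y (suc j) ℚ.- t) (sym (nat-+ M₁ c))))

  -- Here `x₀` enters with a minus sign, which reverses the equation and turns the constant `c` into
  -- `M₁ − c`.
  hole-second : ∀ j c d → c ℕ.+ d ≡ M₁ → ∀ y →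
                val (hyp (suc (punchIn κ j)) (suc κ) c) (e y) ≡ ℚ.- val (hyp zero (suc j) d) y
  hole-second j c d c+d≡M y = trans (cong₂ (λ s t → s ℚ.- t ℚ.- nat c) (e-punched y j) (e-hole y))
    (trans (cong (λ t → y (suc j) ℚ.- (y zero ℚ.- t) ℚ.- nat c) (trans (cong nat (sym c+d≡M)) (nat-+ c d)))
      (solve 4 (λ a b c d → b :- (a :- (c :+ d)) :- c := :- (a :- b :- d)) refl (y zero) (y (suc j)) (nat c) (nat d)))

  -- On the hyperplane `x₀ − x_κ` equals `M₁`, so the value is `M₁ − c`, written as a successor.
  parallel : ∀ {c} → c ℕ.< M₁ → ∀ y → 0ℚ ℚ.< val (hyp zero (suc κ) c) (e y)
  parallel {c} c<M y = subst (0ℚ ℚ.<_)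
    (sym (trans (cong (λ t → y zero ℚ.- t ℚ.- nat c) (e-hole y))
      (trans (cong (λ t → y zero ℚ.- (y zero ℚ.- t) ℚ.- nat c)
                (trans (cong nat (sym (trans (ℕ.+-suc c _) (ℕ.m+[n∸m]≡n c<M)))) (nat-+ c (suc (M₁ ∸ suc c)))))
        (solve 3 (λ a c d → a :- (a :- (c :+ d)) :- c := d) refl (y zero) (nat c) (nat (suc (M₁ ∸ suc c)))))))
    (0<nat-suc (M₁ ∸ suc c))

  B = Deform n (suc M₁) (toℕ κ)
  A = Deform (suc n) M₁ (suc (toℕ κ))

  restrict : ∀ K → K ∈ A → (∃ λ L → L ∈ B × (val K ∘ e) ≈± val L) ⊎ (∀ y → 0ℚ ℚ.< val K (e y))
  restrict _ (low {l} {c} l<1+κ c<M) with punchView κ l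
  ... | hole      = inj₂ (parallel c<M)
  ... | punched j = inj₁ (_ , low (punchIn<⇒ κ (ℕ.≤-pred l<1+κ)) (ℕ.m<n⇒m<1+n c<M) , inj₁ (through-first j c))
  restrict _ (high {l} {c} κ<l c≤M) with punchView κ l
  ... | hole      = contradiction κ<l (ℕ.<-irrefl refl)
  ... | punched j = inj₁ (_ , high (punchIn>⇒ κ κ<l) (ℕ.m≤n⇒m≤1+n c≤M) , inj₁ (through-first j c))
  restrict _ (later (shi {l} {l′} {c} l<l′ c≡)) with punchView κ l | punchView κ l′ | c≡
  ... | hole      | hole       | _ = contradiction l<l′ (ℕ.<-irrefl refl)
  ... | punched i | punched j  | _ =
    inj₁ (_ , later (shi (s<s (punchIn-cancel-< κ (s<s⁻¹ l<l′))) c≡) , inj₁ (through-neither i j c))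
  ... | hole      | punched j  | inj₁ refl =
    inj₁ (_ , high (punchIn>⇒ κ (s<s⁻¹ l<l′)) (ℕ.≤-trans (ℕ.≤-reflexive (ℕ.+-identityʳ M₁)) (ℕ.n≤1+n M₁)) ,
          inj₁ (hole-first j c))
  ... | hole      | punched j  | inj₂ refl =
    inj₁ (_ , high (punchIn>⇒ κ (s<s⁻¹ l<l′)) (ℕ.≤-reflexive (ℕ.+-comm M₁ 1)) , inj₁ (hole-first j c))
  ... | punched j | hole       | inj₁ refl =
    inj₁ (_ , low (punchIn<⇒ κ (ℕ.<⇒≤ (s<s⁻¹ l<l′))) ℕ.≤-refl , inj₂ (hole-second j 0 M₁ refl))
  -- The constant becomes `M₁ − 1`; for it to be a natural number `M₁` has to be a successor. The
  -- case `M₁ = 0` is treated by `Deform₀-restrict`.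
  ... | punched j | hole       | inj₂ refl =
    inj₁ (_ , low (punchIn<⇒ κ (ℕ.<⇒≤ (s<s⁻¹ l<l′))) (ℕ.n≤1+n M₁) , inj₂ (hole-second j 1 M refl))

  extend : ∀ L → L ∈ B → ∃ λ K → K ∈ A × (val K ∘ e) ≈± val L
  extend _ (low {j} {c} j<κ c≤M) with ℕ.m≤n⇒m<n∨m≡n (ℕ.≤-pred c≤M)
  ... | inj₁ c<M  = _ , low (ℕ.m<n⇒m<1+n (<⇒punchIn< κ j<κ)) c<M , inj₁ (through-first j c)
  -- The top constant `M₁` at a low index does not come from `x₀ − x_j`: it is the trace of
  -- `x_j = x_κ`.
  ... | inj₂ refl = _ , later (shi (s<s (<⇒punchIn< κ j<κ)) (inj₁ refl)) , inj₂ (hole-second j 0 M₁ refl)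
  extend _ (high {j} {c} κ≤j c≤1+M) with ℕ.m≤n⇒m<n∨m≡n c≤1+M
  ... | inj₁ c<1+M = _ , high (≤⇒<punchIn κ κ≤j) (ℕ.≤-pred c<1+M) , inj₁ (through-first j c)
  -- Likewise the top constant `M₁ + 1` at a high index is the trace of `x_κ − x_j = 1`.
  ... | inj₂ refl  = _ , later (shi (s<s (≤⇒<punchIn κ κ≤j)) (inj₂ refl)) ,
                     inj₁ (λ y → trans (hole-first j 1 y) (cong (λ t → y zero ℚ.- y (suc j) ℚ.- nat t) (ℕ.+-comm M₁ 1)))
  extend _ (later (shi {i} {j} {c} i<j c≡)) =
    _ , later (shi (s<s (punchIn-mono-< κ (s<s⁻¹ i<j))) c≡) , inj₁ (through-neither i j c)

-- On `x₀ = x_κ` the coordinate `x₀` is eliminated. The remaining `x₀ = x_j` have `j > κ` and become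
-- `x_κ = x_j`, which the Shi arrangement already contains.
Deform₀-restrict : ∀ n (κ : Fin n) →
  IsRestriction (Deform n 0 (suc (toℕ κ))) (hyp zero (suc κ) 0) (Shi n)
Deform₀-restrict n κ = record
  { embed         = e
  ; project       = tail
  ; embed-on      = λ y → solve 1 (λ a → a :- a :- con 0ℚ := con 0ℚ) refl (y κ)
  ; embed-project = embed-project
  ; restrict      = λ K → restrict K
  ; extend        = λ { _ (shi i<j c≡) → _ , later (shi i<j c≡) , inj₁ (λ y → refl) }
  }
  where
  e : ℚ^ n → ℚ^ (suc n)
  e y = y κ ∷ y
  embed-project : ∀ x → val (hyp zero (suc κ) 0) x ≡ 0ℚ → e (tail x) ≗ x
  embed-project x on zero    = trans (sym (ℚ.+-identityˡ _)) (trans (cong (ℚ._+ x (suc κ)) (sym on))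
    (solve 2 (λ a b → (a :- b :- con 0ℚ) :+ b := a) refl (x zero) (x (suc κ))))
  embed-project x on (suc l) = refl
  restrict : ∀ K → K ∈ Deform n 0 (suc (toℕ κ)) →
             (∃ λ L → L ∈ Shi n × (val K ∘ e) ≈± val L) ⊎ (∀ y → 0ℚ ℚ.< val K (e y))
  restrict _ (high κ<j z≤n) = inj₁ (_ , shi (s<s κ<j) (inj₁ refl) , inj₁ (λ y → refl))
  restrict _ (later s)      = inj₁ (_ , s , inj₁ (λ y → refl))

-- No hyperplane involves `x₀`, so the cells are products of a line with Shi cells, and 0 is an
-- arbitrary choice of first coordinate.
cylinder : ∀ {n N} → Reps (Shi n) N → Reps (Deform n 0 n) N
cylinder {n} R = record
  { uniform = λ P h → Ev-map
                (λ { p f _ (later s) → f _ s ; p f _ (high {j} n≤j _) → contradiction n≤j (ℕ.<⇒≱ (Fin.toℕ<n j)) })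
                (uniform (λ p → λ { (hyp i j c) → P p (hyp (suc i) (suc j) c) }) (λ { _ s → h _ (later s) }))
  ; rep     = λ i → 0ℚ ∷ rep i
  ; off     = λ i → lift (off i)
  ; inj     = λ i j e → inj i j (drop e)
  ; find    = λ x o → let i , e = find (tail x) (drop o) in i , lift e
  }
  where
  open Reps R
  lift : ∀ {x y : ℚ^ (suc n)} → tail x ∼[ Shi n ] tail y → x ∼[ Deform n 0 n ] y
  lift (mk∼ e) = mk∼ λ { _ (later s) → e _ s ; _ (high {j} n≤j _) → contradiction n≤j (ℕ.<⇒≱ (Fin.toℕ<n j)) }
  drop : ∀ {x y : ℚ^ (suc n)} → x ∼[ Deform n 0 n ] y → tail x ∼[ Shi n ] tail y
  drop (mk∼ e) = mk∼ λ { (hyp i j c) s → e _ (later s) }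

transversal : ∀ n → ℚ^ (suc n)
transversal n = 1ℚ ∷ λ _ → 0ℚ

Deform-step : ∀ n M k → k ℕ.< suc n → ∀ {a b} → Reps (Deform (suc n) (suc M) (suc k)) a →
  Reps (Deform n (suc (suc M)) k) b → Reps (Deform (suc n) (suc M) k) (a ℕ.+ b)
Deform-step n M k k<n with fromℕ< k<n | Fin.toℕ-fromℕ< k<n
... | κ | refl = λ R S → Reps-resp (Deform-insert (suc n) (suc M) κ)
  (deletion-restriction (transversal _) refl (Deform-restrict n M κ) R S)

Deform₀-step : ∀ n k → k ℕ.< n → ∀ {a b} → Reps (Deform n 0 (suc k)) a →
  Reps (Shi n) b → Reps (Deform n 0 k) (a ℕ.+ b)
Deform₀-step n k k<n with fromℕ< k<n | Fin.toℕ-fromℕ< k<n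
... | κ | refl = λ R S → Reps-resp (Deform-insert n 0 κ)
  (deletion-restriction (transversal _) refl (Deform₀-restrict n κ) R S)

-- At threshold 0 every index is high, at threshold `n` every index is low, and `c ≤ M` means
-- `c < suc M`.
Deform-wrap : ∀ n M → Deform n M 0 ≐ Deform n (suc M) n
Deform-wrap n M = (λ { (high {j} _ c≤M) → low (Fin.toℕ<n j) (s≤s c≤M) ; (later s) → later s }) ,
  λ { (low _ c<1+M) → high z≤n (ℕ.≤-pred c<1+M)
    ; (high {j} n≤j _) → contradiction n≤j (ℕ.<⇒≱ (Fin.toℕ<n j))
    ; (later s) → later s }

Shi≐Deform : ∀ n → Deform n 1 0 ≐ Shi (suc n)
Shi≐Deform n = to , from
  where
  to : Deform n 1 0 ⊆ Shi (suc n)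
  to (high _ z≤n)         = shi (s<s z<s) (inj₁ refl)
  to (high _ (s≤s z≤n))   = shi (s<s z<s) (inj₂ refl)
  to (later (shi i<j c≡)) = shi (s<s i<j) c≡
  from : Shi (suc n) ⊆ Deform n 1 0
  from (shi {zero}  {zero}  i<j c≡)          = contradiction i<j (ℕ.<-irrefl refl)
  from (shi {zero}  {suc j} i<j (inj₁ refl)) = high z≤n z≤n
  from (shi {zero}  {suc j} i<j (inj₂ refl)) = high z≤n (s≤s z≤n)
  from (shi {suc i} {zero}  i<j c≡)          = contradiction i<j λ { (s≤s ()) }
  from (shi {suc i} {suc j} i<j c≡)          = later (shi (s<s⁻¹ i<j) c≡)

Reps-Shi₀ : Reps (Shi 0) 1
Reps-Shi₀ = record
  { uniform = λ P h → 0 , λ { p _ (hyp () _ _) _ }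
  ; rep     = λ _ ()
  ; off     = λ i → mk∼ λ { (hyp () _ _) _ }
  ; inj     = λ { zero zero _ → refl }
  ; find    = λ x o → zero , mk∼ λ { (hyp () _ _) _ }
  }

-- Counting the cells

count : ℕ → ℕ → ℕ → ℕ → ℕ
count n M k d = (n ℕ.+ M) ^ k ℕ.* suc (n ℕ.+ M) ^ d

-- With `s = n + M + 1` the summands are `s` times and once the product of `s ^ k` and
-- `(s + 1) ^ d`.
count-step : ∀ n M k d → count (suc n) M (suc k) d ℕ.+ count n (suc M) k d ≡ count (suc n) M k (suc d)
count-step n M k d rewrite ℕ.+-suc n M =
  solveℕ 3 (λ s a b → (s :*ℕ a) :*ℕ b :+ℕ a :*ℕ b :=ℕ a :*ℕ ((conℕ 1 :+ℕ s) :*ℕ b)) refl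
    (suc (n ℕ.+ M)) (suc (n ℕ.+ M) ^ k) (suc (suc (n ℕ.+ M)) ^ d)
  where open ℕ.+-*-Solver renaming (solve to solveℕ; _:*_ to _:*ℕ_; _:+_ to _:+ℕ_; _:=_ to _:=ℕ_; con to conℕ)

-- The cylinder contributes `a` cells, and each of the `d` hyperplanes `x₀ = x_j` added to it
-- contributes another `a`.
Reps-Deform₀ : ∀ {n a} → Reps (Shi n) a → ∀ k d → k ℕ.+ d ≡ n → Reps (Deform n 0 k) (suc d ℕ.* a)
Reps-Deform₀ {a = a} S k zero e = subst₂ (λ j → Reps (Deform _ 0 j))
  (trans (sym e) (ℕ.+-identityʳ k)) (sym (ℕ.*-identityˡ a)) (cylinder S)
Reps-Deform₀ {n} {a} S k (suc d) e = subst (Reps _) (ℕ.+-comm (suc d ℕ.* a) a)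
  (Deform₀-step n k (subst (k ℕ.<_) e (ℕ.m<m+n k z<s)) (Reps-Deform₀ S (suc k) d (trans (sym (ℕ.+-suc k d)) e)) S)

mutual
  Reps-Shi : ∀ n → Reps (Shi (suc n)) (suc (suc n) ^ n)
  Reps-Shi n = Reps-resp (Shi≐Deform n)
    (subst (Reps _) (trans (ℕ.*-identityˡ _) (cong (λ t → suc t ^ n) (ℕ.+-comm n 1))) (Reps-Deform n 0 0 n refl))

  Reps-Deform-low : ∀ n → Reps (Deform n 0 0) (suc n ^ n)
  Reps-Deform-low zero    = Reps-Deform₀ Reps-Shi₀ 0 0 refl
  Reps-Deform-low (suc n) = Reps-Deform₀ (Reps-Shi n) 0 (suc n) refl

  -- The recursion descends lexicographically in `n`, `M`, `d`: restriction lowers `n`, wrapping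
  -- around lowers `M`, deletion lowers `d`. At `M = 0` and `d = 0` it passes to the Shi arrangement
  -- in `n` coordinates.
  Reps-Deform : ∀ n M k d → k ℕ.+ d ≡ n → Reps (Deform n (suc M) k) (count n (suc M) k d)
  Reps-Deform n zero k zero e rewrite trans (sym (ℕ.+-identityʳ k)) e =
    subst (Reps _) (trans (cong (_^ n) (ℕ.+-comm 1 n)) (sym (ℕ.*-identityʳ _)))
      (Reps-resp (Deform-wrap n 0) (Reps-Deform-low n))
  Reps-Deform n (suc M) k zero e rewrite trans (sym (ℕ.+-identityʳ k)) e =
    subst (Reps _) (trans (ℕ.*-identityˡ _) (trans (cong (_^ n) (sym (ℕ.+-suc n (suc M)))) (sym (ℕ.*-identityʳ _))))
      (Reps-resp (Deform-wrap n (suc M)) (Reps-Deform n M 0 n refl))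
  Reps-Deform zero M k (suc d) e = contradiction (trans (sym (ℕ.+-suc k d)) e) λ ()
  Reps-Deform (suc n) M k (suc d) e = subst (Reps _) (count-step n (suc M) k d)
    (Deform-step n M k (subst (k ℕ.<_) e (ℕ.m<m+n k z<s))
      (Reps-Deform (suc n) M (suc k) d (trans (sym (ℕ.+-suc k d)) e))
      (Reps-Deform n (suc M) k d (ℕ.suc-injective (trans (sym (ℕ.+-suc k d)) e))))

-- From rational cells to connected components

¼ : ℚ → ℚ
¼ ε = ε ℚ.* ½ ℚ.* ½

0<¼ : ∀ {ε} → 0ℚ ℚ.< ε → 0ℚ ℚ.< ¼ ε
0<¼ p = 0<* (0<* p 0<½) 0<½

fromℚ-<⁻ : ∀ {a b} → fromℚ a < fromℚ b → a ℚ.< b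
fromℚ-<⁻ (ε , 0<ε , N , h) = <-by (ℚ.<-≤-trans 0<ε (h N ℕ.≤-refl)) refl

fromℚ-<⁺ : ∀ {a b} → a ℚ.< b → fromℚ a < fromℚ b
fromℚ-<⁺ {a} {b} p = b ℚ.- a , 0<diff p , 0 , λ _ _ → ℚ.≤-refl

<-asymℝ : ∀ {x y} → x < y → ¬ (y < x)
<-asymℝ {x} {y} (ε , 0<ε , e) (δ , 0<δ , d) = let N , h = Ev-× e d ; p , q = h N ℕ.≤-refl in
  ℚ.<-irrefl {0ℚ} {0ℚ} refl (<-by {0ℚ} {0ℚ} (ℚ.<-≤-trans (0<+ 0<ε 0<δ) (ℚ.+-mono-≤ p q))
    (solve 2 (λ x y → con 0ℚ :- con 0ℚ := (y :- x) :+ (x :- y)) refl (seq x N) (seq y N)))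

-- Comparison of a real with a proper rational interval: the constructive
-- substitute for trichotomy.
compare : ∀ (u : ℝ) {a b} → a ℚ.< b → (fromℚ a < u) ⊎ (u < fromℚ b)
compare u {a} {b} a<b = decide (ℚ.≤-total (seq u N) mid)
  where
  δ = ¼ (b ℚ.- a)
  0<δ = 0<¼ (0<diff a<b)
  -- `δ` is a quarter of the interval: the late terms stay within `δ` of term `N`, so comparing that
  -- term with the midpoint leaves a margin `δ` to one end.
  mid = a ℚ.+ δ ℚ.+ δ
  N = proj₁ (cauchy u δ 0<δ)
  close = proj₂ (cauchy u δ 0<δ)
  decide : seq u N ℚ.≤ mid ⊎ mid ℚ.≤ seq u N → (fromℚ a < u) ⊎ (u < fromℚ b)
  decide (inj₁ h) = inj₂ (δ , 0<δ , N , λ p N≤p → ≤-by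
    (0≤+ (0≤diff h) (ℚ.<⇒≤ (0<diff (proj₁ (∣a-b∣<⁻ {seq u p} {seq u N} (close p N N≤p ℕ.≤-refl))))))
    (solve 4 (λ a b u v → (b :- v) :- (b :- a) :* con ½ :* con ½ :=
      (a :+ (b :- a) :* con ½ :* con ½ :+ (b :- a) :* con ½ :* con ½ :- u) :+ ((b :- a) :* con ½ :* con ½ :- (v :- u)))
      refl a b (seq u N) (seq u p)))
  decide (inj₂ h) = inj₁ (δ , 0<δ , N , λ p N≤p → ≤-by
    (0≤+ (0≤diff h) (ℚ.<⇒≤ (0<diff (proj₂ (∣a-b∣<⁻ {seq u p} {seq u N} (close p N N≤p ℕ.≤-refl))))))
    (solve 4 (λ a b u v → (v :- a) :- (b :- a) :* con ½ :* con ½ :=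
      (u :- (a :+ (b :- a) :* con ½ :* con ½ :+ (b :- a) :* con ½ :* con ½)) :+ ((b :- a) :* con ½ :* con ½ :- (u :- v)))
      refl a b (seq u N) (seq u p)))

Below Above : ∀ {n} → Hyperplane n → Pred (ℝ^ n) 0ℓ
Below (hyp i j c) x = x i - x j < fromℕ c
Above (hyp i j c) x = fromℕ c < x i - x j

Off : ∀ {n} → Arrangement n → Pred (ℝ^ n) 0ℓ
Off A = Complement (⋃ A)

-- If y lies on H and x strictly to one side, the difference is carried by
-- one of the two coordinates involved.
apart : ∀ {n} (H : Hyperplane n) {x y} → (Below H x ⊎ Above H x) → y ∈ points H → ∃ λ l → x l # y l
apart (hyp i j c) {x} {y} (inj₁ (ε , 0<ε , x-far)) y-on = conclude (compare (y i - x i) (0<¼ 0<ε))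
  where
  conclude : (fromℚ 0ℚ < y i - x i) ⊎ (y i - x i < fromℚ (¼ ε)) → ∃ λ l → x l # y l
  conclude (inj₁ (δ , 0<δ , h)) = i , inj₁ (δ , 0<δ , Ev-map
    (λ p → subst (δ ℚ.≤_) (solve 1 (λ a → a :- con 0ℚ := a) refl (seq (y i) p ℚ.- seq (x i) p))) h)
  -- Now `y_i − x_i` is below `ε/4`, while `y_i − y_j` is within `ε/2` of `c` and `x_i − x_j` is at
  -- most `c − ε`; hence `x_j` exceeds `y_j`.
  conclude (inj₂ (δ , 0<δ , h)) = j , inj₂ (δ , 0<δ , Ev-map
    (λ p (u , v , t) → ≤-by
      (0≤+ (0≤+ (0≤diff u) (ℚ.<⇒≤ (0<diff (proj₂ (∣a-b∣<⁻ {seq (y i) p ℚ.- seq (y j) p} {nat c} t)))))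
           (0≤+ (0≤diff v) (ℚ.<⇒≤ (0<¼ 0<ε))))
      (solve 7 (λ xi xj yi yj c d e → (xj :- yj) :- d :=
         ((c :- (xi :- xj)) :- e) :+ (e :* con ½ :- (c :- (yi :- yj)))
           :+ (((e :* con ½ :* con ½ :- (yi :- xi)) :- d) :+ e :* con ½ :* con ½))
         refl (seq (x i) p) (seq (x j) p) (seq (y i) p) (seq (y j) p) (nat c) δ ε))
    (Ev-× x-far (Ev-× h (y-on (ε ℚ.* ½) (0<* 0<ε 0<½)))))
apart (hyp i j c) {x} {y} (inj₂ (ε , 0<ε , x-far)) y-on = conclude (compare (x i - y i) (0<¼ 0<ε))
  where
  conclude : (fromℚ 0ℚ < x i - y i) ⊎ (x i - y i < fromℚ (¼ ε)) → ∃ λ l → x l # y l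
  conclude (inj₁ (δ , 0<δ , h)) = i , inj₂ (δ , 0<δ , Ev-map
    (λ p → subst (δ ℚ.≤_) (solve 1 (λ a → a :- con 0ℚ := a) refl (seq (x i) p ℚ.- seq (y i) p))) h)
  conclude (inj₂ (δ , 0<δ , h)) = j , inj₁ (δ , 0<δ , Ev-map
    (λ p (u , v , t) → ≤-by
      (0≤+ (0≤+ (0≤diff u) (ℚ.<⇒≤ (0<diff (proj₁ (∣a-b∣<⁻ {seq (y i) p ℚ.- seq (y j) p} {nat c} t)))))
           (0≤+ (0≤diff v) (ℚ.<⇒≤ (0<¼ 0<ε))))
      (solve 7 (λ xi xj yi yj c d e → (yj :- xj) :- d :=
         (((xi :- xj) :- c) :- e) :+ (e :* con ½ :- ((yi :- yj) :- c))
           :+ (((e :* con ½ :* con ½ :- (xi :- yi)) :- d) :+ e :* con ½ :* con ½))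
         refl (seq (x i) p) (seq (x j) p) (seq (y i) p) (seq (y j) p) (nat c) δ ε))
    (Ev-× x-far (Ev-× h (y-on (ε ℚ.* ½) (0<* 0<ε 0<½)))))

shift : ℝ → ℚ → ℝ
shift x a = mkℝ (λ p → seq x p ℚ.+ a) λ ε 0<ε → let N , h = cauchy x ε 0<ε in
  N , λ p q N≤p N≤q → subst (λ t → ∣ t ∣ ℚ.< ε)
    (solve 3 (λ u v a → u :- v := (u :+ a) :- (v :+ a)) refl (seq x p) (seq x q) a) (h p q N≤p N≤q)

#-irrefl : ∀ {x} → ¬ (x # x)
#-irrefl {x} = [ (λ p → <-asymℝ {x} {x} p p) , (λ p → <-asymℝ {x} {x} p p) ]′

-- Compare x with its translate in direction i onto H.
off⇒side : ∀ {n} {A : Arrangement n} i j c → i ≢ j → hyp i j c ∈ A → ∀ {x} → x ∈ Off A →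
           Below (hyp i j c) x ⊎ Above (hyp i j c) x
off⇒side i j c i≢j m {x} x-off = conclude (x-off y (hyp i j c , m , on))
  where
  y = updateAt x i (const (shift (x j) (nat c)))
  yi : y i ≡ shift (x j) (nat c)
  yi = updateAt-updates i x
  yl : ∀ l → l ≢ i → y l ≡ x l
  yl l l≢i = updateAt-minimal l i x l≢i
  on : y i - y j ≃ fromℕ c
  on ε 0<ε = 0 , λ p _ → subst₂ (λ s t → ∣ seq s p ℚ.- seq t p ℚ.- nat c ∣ ℚ.< ε) (sym yi) (sym (yl j (i≢j ∘ sym)))
    (subst (λ t → ∣ t ∣ ℚ.< ε) (solve 2 (λ a c → con 0ℚ := (a :+ c) :- a :- c) refl (seq (x j) p) (nat c)) 0<ε)
  from-# : x i # shift (x j) (nat c) → Below (hyp i j c) x ⊎ Above (hyp i j c) x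
  from-# (inj₁ (ε , 0<ε , h)) = inj₁ (ε , 0<ε , Ev-map
    (λ p → subst (ε ℚ.≤_) (solve 3 (λ a b c → (b :+ c) :- a := c :- (a :- b)) refl (seq (x i) p) (seq (x j) p) (nat c))) h)
  from-# (inj₂ (ε , 0<ε , h)) = inj₂ (ε , 0<ε , Ev-map
    (λ p → subst (ε ℚ.≤_) (solve 3 (λ a b c → a :- (b :+ c) := (a :- b) :- c) refl (seq (x i) p) (seq (x j) p) (nat c))) h)
  choose : ∀ l → x l # y l → Dec (l ≡ i) → Below (hyp i j c) x ⊎ Above (hyp i j c) x
  choose l x#y (no l≢i)   = contradiction (subst (x l #_) (yl l l≢i) x#y) (#-irrefl {x l})
  choose l x#y (yes refl) = from-# (subst (x l #_) yi x#y)
  conclude : (∃ λ l → x l # y l) → Below (hyp i j c) x ⊎ Above (hyp i j c) x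
  conclude (l , x#y) = choose l x#y (l Fin.≟ i)

-- Two coordinates each move by less than a quarter of the margin, so half of it survives.
Below-open : ∀ {n} (H : Hyperplane n) → Open (Below H)
Below-open (hyp i j c) x (ε , 0<ε , h) = ¼ ε , 0<¼ 0<ε , λ {y} near →
  let _ , 0<δ , near-i = proj₂ (near i)
      _ , 0<δ′ , near-j = proj₁ (near j)
  in ε ℚ.* ½ , 0<* 0<ε 0<½ , Ev-map
    (λ p (u , v , t) → ≤-by (0≤+ (0≤diff u) (0≤+ (ℚ.≤-trans (ℚ.<⇒≤ 0<δ) v) (ℚ.≤-trans (ℚ.<⇒≤ 0<δ′) t)))
      (solve 6 (λ xi xj yi yj c e → (c :- (yi :- yj)) :- e :* con ½ :=
         ((c :- (xi :- xj)) :- e) :+ ((e :* con ½ :* con ½ :- (yi :- xi)) :+ (e :* con ½ :* con ½ :- (xj :- yj))))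
         refl (seq (x i) p) (seq (x j) p) (seq (y i) p) (seq (y j) p) (nat c) ε))
    (Ev-× h (Ev-× near-i near-j))

Above-open : ∀ {n} (H : Hyperplane n) → Open (Above H)
Above-open (hyp i j c) x (ε , 0<ε , h) = ¼ ε , 0<¼ 0<ε , λ {y} near →
  let _ , 0<δ , near-i = proj₁ (near i)
      _ , 0<δ′ , near-j = proj₂ (near j)
  in ε ℚ.* ½ , 0<* 0<ε 0<½ , Ev-map
    (λ p (u , v , t) → ≤-by (0≤+ (0≤diff u) (0≤+ (ℚ.≤-trans (ℚ.<⇒≤ 0<δ) v) (ℚ.≤-trans (ℚ.<⇒≤ 0<δ′) t)))
      (solve 6 (λ xi xj yi yj c e → ((yi :- yj) :- c) :- e :* con ½ :=
         (((xi :- xj) :- c) :- e) :+ ((e :* con ½ :* con ½ :- (xi :- yi)) :+ (e :* con ½ :* con ½ :- (yj :- xj))))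
         refl (seq (x i) p) (seq (x j) p) (seq (y i) p) (seq (y j) p) (nat c) ε))
    (Ev-× h (Ev-× near-i near-j))

-- The counterpart of `SameSide` for a real point, with the side named by a rational one.
data Sides {n} (H : Hyperplane n) (r : ℚ^ n) (x : ℝ^ n) : Set where
  neg : val H r ℚ.< 0ℚ → Below H x → Sides H r x
  pos : 0ℚ ℚ.< val H r → Above H x → Sides H r x

Cell : ∀ {n} → Arrangement n → ℚ^ n → Pred (ℝ^ n) 0ℓ
Cell A r x = ∀ H → H ∈ A → Sides H r x

ι : ∀ {n} → ℚ^ n → ℝ^ n
ι r l = fromℚ (r l)

val<0⇒Below : ∀ {n} (H : Hyperplane n) r → val H r ℚ.< 0ℚ → Below H (ι r)
val<0⇒Below (hyp i j c) r p = fromℚ-<⁺ {r i ℚ.- r j} {nat c}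
  (<-by (neg⇒0<- p) (solve 2 (λ a b → b :- a := :- (a :- b)) refl (r i ℚ.- r j) (nat c)))

0<val⇒Above : ∀ {n} (H : Hyperplane n) r → 0ℚ ℚ.< val H r → Above H (ι r)
0<val⇒Above (hyp i j c) r p = fromℚ-<⁺ {nat c} {r i ℚ.- r j} (<-by p refl)

Below⇒val<0 : ∀ {n} (H : Hyperplane n) r → Below H (ι r) → val H r ℚ.< 0ℚ
Below⇒val<0 (hyp i j c) r p = <-by (0<diff (fromℚ-<⁻ {r i ℚ.- r j} {nat c} p))
  (solve 2 (λ a b → con 0ℚ :- (a :- b) := b :- a) refl (r i ℚ.- r j) (nat c))

Above⇒0<val : ∀ {n} (H : Hyperplane n) r → Above H (ι r) → 0ℚ ℚ.< val H r
Above⇒0<val (hyp i j c) r p = 0<diff (fromℚ-<⁻ {nat c} {r i ℚ.- r j} p)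

Sides⇒SameSide : ∀ {n} (H : Hyperplane n) r s → Sides H r (ι s) → SameSide (val H r) (val H s)
Sides⇒SameSide H r s (neg p q) = neg p (Below⇒val<0 H s q)
Sides⇒SameSide H r s (pos p q) = pos p (Above⇒0<val H s q)

SameSide⇒Sides : ∀ {n} (H : Hyperplane n) r s → SameSide (val H r) (val H s) → Sides H r (ι s)
SameSide⇒Sides H r s (neg p q) = neg p (val<0⇒Below H s q)
SameSide⇒Sides H r s (pos p q) = pos p (0<val⇒Above H s q)

∼⇒Cell : ∀ {n} {A : Arrangement n} {r s} → r ∼[ A ] s → ι s ∈ Cell A r
∼⇒Cell {r = r} {s} e H m = SameSide⇒Sides H r s (sides e H m)

Cell⇒∼ : ∀ {n} {A : Arrangement n} {r s} → ι s ∈ Cell A r → r ∼[ A ] s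
Cell⇒∼ {r = r} {s} e = mk∼ λ H m → Sides⇒SameSide H r s (e H m)

Cell-mono : ∀ {n} {A : Arrangement n} {r s} → r ∼[ A ] s → Cell A s ⊆ Cell A r
Cell-mono {r = r} {s} e {x} c H m = move (sides e H m) (c H m)
  where
  move : SameSide (val H r) (val H s) → Sides H s x → Sides H r x
  move (neg p q) (neg _ t) = neg p t
  move (neg p q) (pos s t) = contradiction s (ℚ.<-asym q)
  move (pos p q) (neg s t) = contradiction s (ℚ.<-asym q)
  move (pos p q) (pos _ t) = pos p t

approx : ∀ {n} → ℝ^ n → ℕ → ℚ^ n
approx x p l = seq (x l) p

approx-side : ∀ {n} (H : Hyperplane n) x → (Below H x → Ev (λ p → val H (approx x p) ℚ.< 0ℚ)) ×
                                           (Above H x → Ev (λ p → 0ℚ ℚ.< val H (approx x p)))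
approx-side (hyp i j c) x =
  (λ (ε , 0<ε , h) → Ev-map (λ p u → <-by (ℚ.<-≤-trans 0<ε u)
     (solve 2 (λ a b → con 0ℚ :- (a :- b) := b :- a) refl (seq (x i) p ℚ.- seq (x j) p) (nat c))) h) ,
  (λ (ε , 0<ε , h) → Ev-map (λ p u → ℚ.<-≤-trans 0<ε u) h)

approx∈Cell : ∀ {n} {A : Arrangement n} {r x} → Uniform A → x ∈ Cell A r →
              Ev (λ p → ι (approx x p) ∈ Cell A r)
approx∈Cell {A = A} {r} {x} u x∈ = u (λ p H → Sides H r (ι (approx x p))) λ H m → each H (x∈ H m)
  where
  each : ∀ H → Sides H r x → Ev (λ p → Sides H r (ι (approx x p)))
  each H (neg p q) = Ev-map (λ n h → neg p (val<0⇒Below H (approx x n) h)) (proj₁ (approx-side H x) q)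
  each H (pos p q) = Ev-map (λ n h → pos p (0<val⇒Above H (approx x n) h)) (proj₂ (approx-side H x) q)

approx∈Ball : ∀ {n} (x : ℝ^ n) ε → 0ℚ ℚ.< ε → Ev (λ p → ι (approx x p) ∈ Ball x ε)
approx∈Ball x ε 0<ε = Ev-Fin λ i →
  let N , h = cauchy (x i) (ε ℚ.* ½) (0<* 0<ε 0<½)
  in N , λ p N≤p →
    (ε ℚ.* ½ , 0<* 0<ε 0<½ , N , λ q N≤q → bound (seq (x i) q) (seq (x i) p) (h q p N≤q N≤p)) ,
    (ε ℚ.* ½ , 0<* 0<ε 0<½ , N , λ q N≤q → bound (seq (x i) p) (seq (x i) q) (h p q N≤p N≤q))
  where
  bound : ∀ a b → ∣ a ℚ.- b ∣ ℚ.< ε ℚ.* ½ → ε ℚ.* ½ ℚ.≤ ε ℚ.- (a ℚ.- b)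
  bound a b h = ≤-by (ℚ.<⇒≤ (0<diff (proj₁ (∣a-b∣<⁻ {a} {b} h))))
    (solve 3 (λ a b e → (e :- (a :- b)) :- e :* con ½ := e :* con ½ :- (a :- b)) refl a b ε)

Cell⊆Off : ∀ {n} {A : Arrangement n} {r} → Cell A r ⊆ Off A
Cell⊆Off {r = r} {x} x∈ y (H , m , on) = apart H {x} {y} (strict (x∈ H m)) on
  where
  strict : Sides H r x → Below H x ⊎ Above H x
  strict (neg _ p) = inj₁ p
  strict (pos _ p) = inj₂ p

-- Connectedness of the cells by bisection of segments

mix-bound : ∀ {a b} → 0ℚ ℚ.< a → 0ℚ ℚ.< b →
            ∃ λ m → 0ℚ ℚ.< m × (∀ t → 0ℚ ℚ.≤ t → t ℚ.≤ 1ℚ → m ℚ.≤ (1ℚ ℚ.- t) ℚ.* a ℚ.+ t ℚ.* b)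
mix-bound {a} {b} 0<a 0<b with ℚ.≤-total a b
... | inj₁ a≤b = a , 0<a , λ t 0≤t t≤1 → ≤-by (0≤* 0≤t (0≤diff a≤b))
  (solve 3 (λ a b t → ((con 1ℚ :- t) :* a :+ t :* b) :- a := t :* (b :- a)) refl a b t)
... | inj₂ b≤a = b , 0<b , λ t 0≤t t≤1 → ≤-by (0≤* (0≤diff t≤1) (0≤diff b≤a))
  (solve 3 (λ a b t → ((con 1ℚ :- t) :* a :+ t :* b) :- b := (con 1ℚ :- t) :* (a :- b)) refl a b t)

module _ {n} {a b : ℚ^ n} {A : Arrangement n} {r : ℚ^ n}
         (a∈ : r ∼[ A ] a) (b∈ : r ∼[ A ] b) where

  segment : ℚ → ℚ^ n
  segment t l = (1ℚ ℚ.- t) ℚ.* a l ℚ.+ t ℚ.* b l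

  val-segment : ∀ H t → val H (segment t) ≡ (1ℚ ℚ.- t) ℚ.* val H a ℚ.+ t ℚ.* val H b
  val-segment H t = val-mix H a b (1ℚ ℚ.- t) t (b-a+a t 1ℚ)

  -- The distance from `H` is bounded below along the whole segment by its smaller value at the
  -- ends. Positivity at each point alone would not survive the passage to a limit.
  sides-bound : ∀ H → SameSide (val H r) (val H a) → SameSide (val H r) (val H b) →
    (val H r ℚ.< 0ℚ × ∃ λ m → 0ℚ ℚ.< m × (∀ t → 0ℚ ℚ.≤ t → t ℚ.≤ 1ℚ → m ℚ.≤ ℚ.- val H (segment t))) ⊎
    (0ℚ ℚ.< val H r × ∃ λ m → 0ℚ ℚ.< m × (∀ t → 0ℚ ℚ.≤ t → t ℚ.≤ 1ℚ → m ℚ.≤ val H (segment t)))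
  sides-bound H (neg r<0 a<0) (neg _ b<0) =
    let m , 0<m , h = mix-bound (neg⇒0<- a<0) (neg⇒0<- b<0) in
    inj₁ (r<0 , m , 0<m , λ t 0≤t t≤1 → subst (m ℚ.≤_)
      (trans (solve 4 (λ α β x y → α :* :- x :+ β :* :- y := :- (α :* x :+ β :* y)) refl
                 (1ℚ ℚ.- t) t (val H a) (val H b))
        (cong ℚ.-_ (sym (val-segment H t)))) (h t 0≤t t≤1))
  sides-bound H (pos 0<r 0<a) (pos _ 0<b) =
    let m , 0<m , h = mix-bound 0<a 0<b in
    inj₂ (0<r , m , 0<m , λ t 0≤t t≤1 →
      subst (m ℚ.≤_) (sym (val-segment H t)) (h t 0≤t t≤1))
  sides-bound H (neg r<0 _) (pos 0<r _) = contradiction 0<r (ℚ.<-asym r<0)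
  sides-bound H (pos 0<r _) (neg r<0 _) = contradiction 0<r (ℚ.<-asym r<0)

  segment∈Cell : ∀ t → 0ℚ ℚ.≤ t → t ℚ.≤ 1ℚ → ι (segment t) ∈ Cell A r
  segment∈Cell t 0≤t t≤1 H m = [
    (λ (r<0 , ε , 0<ε , h) → neg r<0 (val<0⇒Below H (segment t)
      (subst (ℚ._< 0ℚ) (solve 1 (λ a → :- :- a := a) refl (val H (segment t))) (pos⇒-<0 (ℚ.<-≤-trans 0<ε (h t 0≤t t≤1)))))) ,
    (λ (0<r , ε , 0<ε , h) → pos 0<r (0<val⇒Above H (segment t) (ℚ.<-≤-trans 0<ε (h t 0≤t t≤1)))) ]′
    (sides-bound H (sides a∈ H m) (sides b∈ H m))

  module Limit (s t : ℕ → ℚ)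
               (s-mono : ∀ {p q} → p ℕ.≤ q → s p ℚ.≤ s q)
               (t-mono : ∀ {p q} → p ℕ.≤ q → t q ℚ.≤ t p)
               (gap : ∀ p → t p ℚ.- s p ≡ ½^ p)
               (0≤s : ∀ p → 0ℚ ℚ.≤ s p) (t≤1 : ∀ p → t p ℚ.≤ 1ℚ) where

    s≤t : ∀ p → s p ℚ.≤ t p
    s≤t p = ≤-by (ℚ.<⇒≤ (0<½^ p)) (gap p)

    -- The difference is `(u − v)(b − a)` in coordinate `l`, and both parameters lie in an interval
    -- of length `½^ N`.
    trapped : ∀ N {u v} → s N ℚ.≤ u → u ℚ.≤ t N → s N ℚ.≤ v → v ℚ.≤ t N → ∀ l →
              segment u l ℚ.- segment v l ℚ.≤ ½^ N ℚ.* ∣ b l ℚ.- a l ∣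
    trapped N {u} {v} s≤u u≤t s≤v v≤t l = cases (ℚ.≤-total u v)
      where
      k = ∣ b l ℚ.- a l ∣
      cases : u ℚ.≤ v ⊎ v ℚ.≤ u → segment u l ℚ.- segment v l ℚ.≤ ½^ N ℚ.* k
      cases (inj₁ u≤v) = subst (λ e → segment u l ℚ.- segment v l ℚ.≤ e ℚ.* k) (gap N)
        (≤-by (0≤+ (0≤* (0≤+ (0≤diff s≤u) (0≤diff v≤t)) (ℚ.0≤∣p∣ (b l ℚ.- a l)))
                   (0≤* (0≤diff u≤v) (0≤diff (-a≤∣a∣ (b l ℚ.- a l)))))
          (solve 7 (λ s t u v a b k → (t :- s) :* k :- (((con 1ℚ :- u) :* a :+ u :* b) :- ((con 1ℚ :- v) :* a :+ v :* b))
             := ((u :- s) :+ (t :- v)) :* k :+ (v :- u) :* (k :- :- (b :- a))) refl (s N) (t N) u v (a l) (b l) k))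
      cases (inj₂ v≤u) = subst (λ e → segment u l ℚ.- segment v l ℚ.≤ e ℚ.* k) (gap N)
        (≤-by (0≤+ (0≤* (0≤+ (0≤diff s≤v) (0≤diff u≤t)) (ℚ.0≤∣p∣ (b l ℚ.- a l)))
                   (0≤* (0≤diff v≤u) (0≤diff (a≤∣a∣ (b l ℚ.- a l)))))
          (solve 7 (λ s t u v a b k → (t :- s) :* k :- (((con 1ℚ :- u) :* a :+ u :* b) :- ((con 1ℚ :- v) :* a :+ v :* b))
             := ((v :- s) :+ (t :- u)) :* k :+ (u :- v) :* (k :- (b :- a))) refl (s N) (t N) u v (a l) (b l) k))

    s∈[s,t] : ∀ {N p} → N ℕ.≤ p → s N ℚ.≤ s p × s p ℚ.≤ t N
    s∈[s,t] h = s-mono h , ℚ.≤-trans (s≤t _) (t-mono h)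

    closeness : ∀ l ε N → ½^ N ℚ.* ∣ b l ℚ.- a l ∣ ℚ.< ε → ∀ p q → N ℕ.≤ p → N ℕ.≤ q →
                ∣ segment (s p) l ℚ.- segment (s q) l ∣ ℚ.< ε
    closeness l ε N small p q N≤p N≤q = ∣a∣<⁺
      (ℚ.≤-<-trans (trapped N sp pt sq qt l) small)
      (ℚ.≤-<-trans (subst (ℚ._≤ ½^ N ℚ.* ∣ b l ℚ.- a l ∣)
         (solve 2 (λ x y → y :- x := :- (x :- y)) refl (segment (s p) l) (segment (s q) l))
         (trapped N sq qt sp pt l)) small)
      where
      sp = s-mono N≤p
      pt = ℚ.≤-trans (s≤t p) (t-mono N≤p)
      sq = s-mono N≤q
      qt = ℚ.≤-trans (s≤t q) (t-mono N≤q)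

    -- It is built from the lower ends; `near` shows that the upper ends converge to it too.
    limit : ℝ^ n
    limit l = mkℝ (λ p → segment (s p) l) λ ε 0<ε →
      let N , small = ½^*K<ε ∣ b l ℚ.- a l ∣ (ℚ.0≤∣p∣ (b l ℚ.- a l)) 0<ε in
      N , closeness l ε N (small N ℕ.≤-refl)

    near : ∀ ε → 0ℚ ℚ.< ε → Ev (λ p → ι (segment (s p)) ∈ Ball limit ε × ι (segment (t p)) ∈ Ball limit ε)
    near ε 0<ε = Ev-map (λ p h → (λ l → proj₁ (h l)) , (λ l → proj₂ (h l)))
      (Ev-Fin λ l → Ev-map (λ p h → close l p h (s p) ℚ.≤-refl (s≤t p) , close l p h (t p) (s≤t p) ℚ.≤-refl)
        (½^*K<ε ∣ b l ℚ.- a l ∣ (ℚ.0≤∣p∣ (b l ℚ.- a l)) (0<* 0<ε 0<½)))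
      where
      close : ∀ l p → ½^ p ℚ.* ∣ b l ℚ.- a l ∣ ℚ.< ε ℚ.* ½ → ∀ u → s p ℚ.≤ u → u ℚ.≤ t p →
              (limit l - fromℚ (segment u l) < fromℚ ε) × (fromℚ (segment u l) - limit l < fromℚ ε)
      close l p h u s≤u u≤t =
        (ε ℚ.* ½ , 0<* 0<ε 0<½ , p , λ q p≤q → let sq , qt = s∈[s,t] p≤q in
          half (ℚ.≤-<-trans (trapped p sq qt s≤u u≤t l) h)) ,
        (ε ℚ.* ½ , 0<* 0<ε 0<½ , p , λ q p≤q → let sq , qt = s∈[s,t] p≤q in
          half (ℚ.≤-<-trans (trapped p s≤u u≤t sq qt l) h))
        where
        half : ∀ {d} → d ℚ.< ε ℚ.* ½ → ε ℚ.* ½ ℚ.≤ ε ℚ.- d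
        half {d} h = ≤-by (ℚ.<⇒≤ (0<diff h)) (solve 2 (λ d e → (e :- d) :- e :* con ½ := e :* con ½ :- d) refl d ε)

    limit∈Cell : limit ∈ Cell A r
    limit∈Cell H@(hyp i j c) m = [
      (λ (r<0 , ε , 0<ε , h) → neg r<0 (ε , 0<ε , 0 , λ p _ → subst (ε ℚ.≤_)
        (solve 3 (λ x y c → :- (x :- y :- c) := c :- (x :- y)) refl (segment (s p) i) (segment (s p) j) (nat c))
        (h (s p) (0≤s p) (ℚ.≤-trans (s≤t p) (t≤1 p))))) ,
      (λ (0<r , ε , 0<ε , h) → pos 0<r (ε , 0<ε , 0 , λ p _ → h (s p) (0≤s p) (ℚ.≤-trans (s≤t p) (t≤1 p)))) ]′
      (sides-bound H (sides a∈ H m) (sides b∈ H m))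

  module _ {U V : Pred (ℝ^ n) 0ℓ} (cover : Cell A r ⊆ U ∪ V) where

    record Bracket (p : ℕ) : Set where
      field
        s t : ℚ
        gap : t ℚ.- s ≡ ½^ p
        0≤s : 0ℚ ℚ.≤ s
        t≤1 : t ℚ.≤ 1ℚ
        s∈U : ι (segment s) ∈ U
        t∈V : ι (segment t) ∈ V
    open Bracket

    -- The cover says which of `U` and `V` contains the midpoint, and the midpoint replaces the end
    -- belonging to that set.
    bisect : ∀ {p} (B : Bracket p) → ∃ λ (B′ : Bracket (suc p)) → s B ℚ.≤ s B′ × t B′ ℚ.≤ t B
    bisect {p} B = pick (cover {ι (segment m)} (segment∈Cell m 0≤m m≤1))
      where
      m = s B ℚ.+ ½^ (suc p)
      0≤w = ℚ.<⇒≤ (0<½^ (suc p))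
      s≤m : s B ℚ.≤ m
      s≤m = ≤-by 0≤w (solve 2 (λ s v → (s :+ v) :- s := v) refl (s B) (½^ (suc p)))
      t-m : t B ℚ.- m ≡ ½^ (suc p)
      t-m = begin
        t B ℚ.- (s B ℚ.+ ½^ p ℚ.* ½)
          ≡⟨ solve 3 (λ t s v → t :- (s :+ v :* con ½) := (t :- s) :- v :* con ½) refl (t B) (s B) (½^ p) ⟩
        (t B ℚ.- s B) ℚ.- ½^ p ℚ.* ½
          ≡⟨ cong (ℚ._- ½^ p ℚ.* ½) (gap B) ⟩
        ½^ p ℚ.- ½^ p ℚ.* ½
          ≡⟨ solve 1 (λ v → v :- v :* con ½ := v :* con ½) refl (½^ p) ⟩
        ½^ p ℚ.* ½ ∎
        where open ≡-Reasoning
      m≤t : m ℚ.≤ t B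
      m≤t = ≤-by 0≤w t-m
      0≤m = ℚ.≤-trans (0≤s B) s≤m
      m≤1 = ℚ.≤-trans m≤t (t≤1 B)
      pick : ι (segment m) ∈ U ∪ V → ∃ λ (B′ : Bracket (suc p)) → s B ℚ.≤ s B′ × t B′ ℚ.≤ t B
      pick (inj₁ m∈U) = record { s = m ; t = t B ; gap = t-m ; 0≤s = 0≤m ; t≤1 = t≤1 B ; s∈U = m∈U ; t∈V = t∈V B } ,
        s≤m , ℚ.≤-refl
      pick (inj₂ m∈V) = record { s = s B ; t = m ; gap = solve 2 (λ s v → (s :+ v) :- s := v) refl (s B) (½^ (suc p))
                               ; 0≤s = 0≤s B ; t≤1 = m≤1 ; s∈U = s∈U B ; t∈V = m∈V } ,
        ℚ.≤-refl , m≤t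

    module _ (B₀ : Bracket 0) (U-open : Open U) (V-open : Open V) where
      private
        bracket : ∀ p → Bracket p
        bracket zero    = B₀
        bracket (suc p) = proj₁ (bisect (bracket p))

        s-mono′ : ∀ {p q} → p ℕ.≤′ q → s (bracket p) ℚ.≤ s (bracket q)
        s-mono′ ℕ.≤′-refl           = ℚ.≤-refl
        s-mono′ (ℕ.≤′-step {q} p≤q) = ℚ.≤-trans (s-mono′ p≤q) (proj₁ (proj₂ (bisect (bracket q))))

        t-mono′ : ∀ {p q} → p ℕ.≤′ q → t (bracket q) ℚ.≤ t (bracket p)
        t-mono′ ℕ.≤′-refl           = ℚ.≤-refl
        t-mono′ (ℕ.≤′-step {q} p≤q) = ℚ.≤-trans (proj₂ (proj₂ (bisect (bracket q)))) (t-mono′ p≤q)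

        open Limit (λ p → s (bracket p)) (λ p → t (bracket p)) (s-mono′ ∘ ℕ.≤⇒≤′) (t-mono′ ∘ ℕ.≤⇒≤′)
          (λ p → gap (bracket p)) (λ p → 0≤s (bracket p)) (λ p → t≤1 (bracket p))

        s∈Cell : ∀ p → ι (segment (s (bracket p))) ∈ Cell A r
        s∈Cell p = segment∈Cell _ (0≤s (bracket p)) (ℚ.≤-trans (s≤t p) (t≤1 (bracket p)))

        t∈Cell : ∀ p → ι (segment (t (bracket p))) ∈ Cell A r
        t∈Cell p = segment∈Cell _ (ℚ.≤-trans (0≤s (bracket p)) (s≤t p)) (t≤1 (bracket p))

      -- Whichever of U and V contains the limit contains late endpoints of
      -- both kinds.
      U∩V-point : Satisfiable (Cell A r ∩ (U ∩ V))
      U∩V-point = [ in-U , in-V ]′ (cover {limit} limit∈Cell)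
        where
        in-U : limit ∈ U → Satisfiable (Cell A r ∩ (U ∩ V))
        in-U z∈U =
          let ε , 0<ε , ball⊆U = U-open limit z∈U
              N , close = near ε 0<ε
              y = ι (segment (t (bracket N)))
          in y , t∈Cell N , ball⊆U {y} (proj₂ (close N ℕ.≤-refl)) , t∈V (bracket N)
        in-V : limit ∈ V → Satisfiable (Cell A r ∩ (U ∩ V))
        in-V z∈V =
          let ε , 0<ε , ball⊆V = V-open limit z∈V
              N , close = near ε 0<ε
              y = ι (segment (s (bracket N)))
          in y , s∈Cell N , s∈U (bracket N) , ball⊆V {y} (proj₁ (close N ℕ.≤-refl))

-- An open set need not respect pointwise equality of functions by
-- definition, but its balls do.
Open-resp : ∀ {n} {U : Pred (ℝ^ n) 0ℓ} {a b : ℚ^ n} → Open U → a ≗ b → ι a ∈ U → ι b ∈ U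
Open-resp {a = a} {b} U-open e a∈U =
  let ε , 0<ε , ball⊆U = U-open (ι a) a∈U
  in ball⊆U {ι b} λ i →
    (ε , 0<ε , 0 , λ _ _ → ℚ.≤-reflexive (trans (ε≡ ε (a i)) (cong (λ t → ε ℚ.- (a i ℚ.- t)) (e i)))) ,
    (ε , 0<ε , 0 , λ _ _ → ℚ.≤-reflexive (trans (ε≡ ε (a i)) (cong (λ t → ε ℚ.- (t ℚ.- a i)) (e i))))
  where
  ε≡ : ∀ ε a → ε ≡ ε ℚ.- (a ℚ.- a)
  ε≡ = solve 2 (λ ε a → ε := ε :- (a :- a)) refl

-- The segment argument wants rational ends. Late approximations of `x` lie both in its cell and in
-- a ball inside `U`.
rational-point : ∀ {n} {A : Arrangement n} {r} {U : Pred (ℝ^ n) 0ℓ} → Uniform A → Open U →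
                 Satisfiable (Cell A r ∩ U) → ∃ λ a → r ∼[ A ] a × ι a ∈ U
rational-point {r = r} u U-open (x , x∈C , x∈U) =
  let ε , 0<ε , ball⊆U = U-open x x∈U
      N , h = Ev-× (approx∈Cell {r = r} {x} u x∈C) (approx∈Ball x ε 0<ε)
      in-C , in-ball = h N ℕ.≤-refl
  in approx x N , Cell⇒∼ in-C , ball⊆U {ι (approx x N)} in-ball

Cell-connected : ∀ {n} {A : Arrangement n} {r} → Uniform A → Connected (Cell A r)
Cell-connected {A = A} {r} u U V U-open V-open cover CU CV =
  let a , a∼ , a∈U = rational-point {r = r} u U-open CU
      b , b∼ , b∈V = rational-point {r = r} u V-open CV
  in U∩V-point a∼ b∼ cover (record
    { s = 0ℚ ; t = 1ℚ ; gap = refl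
    ; 0≤s = ℚ.≤-refl ; t≤1 = ℚ.≤-refl
    ; s∈U = Open-resp U-open (λ l → solve 2 (λ a b → a := (con 1ℚ :- con 0ℚ) :* a :+ con 0ℚ :* b) refl (a l) (b l)) a∈U
    ; t∈V = Open-resp V-open (λ l → solve 2 (λ a b → b := (con 1ℚ :- con 1ℚ) :* a :+ con 1ℚ :* b) refl (a l) (b l)) b∈V
    }) U-open V-open

-- Cells are exactly the regions

module _ {n} {A : Arrangement n} (proper : ∀ i j c → hyp i j c ∈ A → i ≢ j) where

  -- The two sides of a hyperplane of `A` are open, disjoint and cover `D`, so `D` cannot meet both.
  connected⊆Cell : ∀ {r} {D : Pred (ℝ^ n) 0ℓ} → D ⊆ Off A → Connected D →
                   ∀ {x} → x ∈ D → x ∈ Cell A r → D ⊆ Cell A r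
  connected⊆Cell {r} {D} D⊆Off conn {x} x∈D x∈C {y} y∈D H@(hyp i j c) m = compare-sides (x∈C H m) (side y y∈D)
    where
    side : ∀ z → z ∈ D → Below H z ⊎ Above H z
    side z z∈D = off⇒side i j c (proper i j c m) m {z} (D⊆Off {z} z∈D)
    separated : ∀ {u v} → u ∈ D → v ∈ D → Below H u → Above H v → ⊥
    separated {u} {v} u∈D v∈D u-below v-above =
      let z , _ , z-below , z-above = conn (Below H) (Above H) (Below-open H) (Above-open H)
                                        (λ {z} → side z) (u , u∈D , u-below) (v , v∈D , v-above)
      in <-asymℝ {z i - z j} {fromℕ c} z-below z-above
    compare-sides : Sides H r x → Below H y ⊎ Above H y → Sides H r y
    compare-sides (neg p _) (inj₁ q) = neg p q
    compare-sides (pos p _) (inj₂ q) = pos p q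
    compare-sides (neg p q) (inj₂ s) = ⊥-elim (separated {x} {y} x∈D y∈D q s)
    compare-sides (pos p q) (inj₁ s) = ⊥-elim (separated {y} {x} y∈D x∈D s q)

  Cell-isRegion : ∀ {r} → Uniform A → r ∼[ A ] r → IsRegion A (Cell A r)
  Cell-isRegion {r} u r-off = record
    { nonempty  = ι r , ∼⇒Cell r-off
    ; contained = λ {x} → Cell⊆Off {r = r} {x}
    ; connected = Cell-connected {r = r} u
    ; maximal   = λ D D⊆Off conn C⊆D {y} →
        connected⊆Cell {r} {D} D⊆Off conn {ι r} (C⊆D {ι r} (∼⇒Cell r-off)) (∼⇒Cell r-off) {y}
    }

  -- The cell is named by an approximation of `x` so late that it lies on the side of `x` for all
  -- hyperplanes at once.
  cell-of : Uniform A → ∀ {x} → x ∈ Off A → ∃ λ r → x ∈ Cell A r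
  cell-of u {x} x-off =
    let N , h = u (λ p H → Sides H (approx x p) x) each in approx x N , h N ℕ.≤-refl
    where
    each : ∀ H → H ∈ A → Ev (λ p → Sides H (approx x p) x)
    each H@(hyp i j c) m = [ (λ q → Ev-map (λ _ h → neg h q) (proj₁ (approx-side H x) q)) ,
                             (λ q → Ev-map (λ _ h → pos h q) (proj₂ (approx-side H x) q)) ]′
                             (off⇒side i j c (proper i j c m) m {x} x-off)

  Cell⇒off : ∀ {r x} → x ∈ Cell A r → r ∼[ A ] r
  Cell⇒off {r} {x} x∈C = mk∼ λ H m → self (x∈C H m)
    where
    self : ∀ {H} → Sides H r x → SameSide (val H r) (val H r)
    self (neg p _) = neg p p
    self (pos p _) = pos p p

  regions : ∀ {N} → Reps A N → HasExactlyRegions A N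
  regions {N} R = record
    { to        = λ i → Cell A (rep i) , Cell-isRegion uniform (off i)
    ; cong      = λ { refl → (λ z → z) , (λ z → z) }
    ; bijective = (λ {i} {j} (_ , ⊇) → inj i j (Cell⇒∼ (⊇ {ι (rep j)} (∼⇒Cell (off j))))) ,
                  λ (C , C-region) → surjective C C-region
    }
    where
    open Reps R
    surjective : ∀ C → IsRegion A C → ∃ λ i → ∀ {j} → j ≡ i → Cell A (rep j) ≐ C
    surjective C C-region = i , λ { refl → (λ {y} → Cell⊆C {y}) , (λ {y} → C⊆Cell {y}) }
      where
      open IsComponent C-region
      x = proj₁ nonempty
      x∈C = proj₂ nonempty
      rx = cell-of uniform {x} (contained {x} x∈C)
      located = find (proj₁ rx) (Cell⇒off {proj₁ rx} {x} (proj₂ rx))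
      i = proj₁ located
      x∈Cell : x ∈ Cell A (rep i)
      x∈Cell = Cell-mono (∼-sym (proj₂ located)) {x} (proj₂ rx)
      C⊆Cell : C ⊆ Cell A (rep i)
      C⊆Cell {y} = connected⊆Cell {rep i} {C} (λ {z} → contained {z}) connected {x} x∈C x∈Cell {y}
      Cell⊆C : Cell A (rep i) ⊆ C
      -- The cell is connected, avoids the arrangement and contains `C`, so maximality of `C` gives
      -- the reverse inclusion.
      Cell⊆C {y} = maximal (Cell A (rep i)) (λ {z} → Cell⊆Off {r = rep i} {z})
        (Cell-connected {r = rep i} uniform) (λ {z} → C⊆Cell {z}) {y}

-- Translation to the numbering of the theorem

Deform≐ShiDeformation : ∀ n m k → Deform n (suc m) k ≐ ShiDeformation (suc n) m (2 + k)
Deform≐ShiDeformation n m k = to , from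
  where
  to : Deform n (suc m) k ⊆ ShiDeformation (suc n) m (2 + k)
  to (low j<k c<1+m)      = first-<k refl (s≤s (s≤s z≤n)) (s<s (s<s j<k)) (ℕ.≤-pred c<1+m)
  to (high k≤j c≤1+m)     = first-≥k refl (s≤s (s≤s k≤j)) c≤1+m
  to (later (shi i<j c≡)) = rest (s≤s (s≤s z≤n)) (s<s i<j) c≡
  from : ShiDeformation (suc n) m (2 + k) ⊆ Deform n (suc m) k
  from (first-<k {zero} {zero}  _ (s≤s ()) _ _)
  from (first-<k {zero} {suc j} _ _ j<k c≤m)   = low (s<s⁻¹ (s<s⁻¹ j<k)) (s≤s c≤m)
  from (first-≥k {zero} {zero}  _ (s≤s ()) _)
  from (first-≥k {zero} {suc j} _ k≤j c≤1+m)   = high (ℕ.≤-pred (ℕ.≤-pred k≤j)) c≤1+m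
  from (rest {zero}  {_}     (s≤s ()) _ _)
  from (rest {suc i} {zero}  _ (s≤s ()) _)
  from (rest {suc i} {suc j} _ i<j c≡)         = later (shi (s<s⁻¹ i<j) c≡)

Shi-proper : ∀ {n} i j c → hyp i j c ∈ Shi n → i ≢ j
Shi-proper i .i c (shi i<i _) refl = ℕ.<-irrefl refl i<i

-- The bound on `k` keeps `first-≥k` from admitting the degenerate equation `x₁ − x₁ = c`.
ShiDeformation-proper : ∀ {n m k} i j c → 2 ≤ k → hyp i j c ∈ ShiDeformation n m k → i ≢ j
ShiDeformation-proper i .i c _   (first-<k i≡1 2≤i _ _) refl = ℕ.<-irrefl (sym i≡1) 2≤i
ShiDeformation-proper i .i c 2≤k (first-≥k i≡1 k≤i _)   refl = ℕ.<-irrefl (sym i≡1) (ℕ.≤-trans 2≤k k≤i)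
ShiDeformation-proper i .i c _   (rest _ i<i _)         refl = ℕ.<-irrefl refl i<i

theorem4p1 : ((n m k : ℕ) → 1 ≤ n → 2 ≤ k → k ≤ n + 1 →
    HasExactlyRegions (ShiDeformation n m k)
    ((n + m) ^ (k ∸ 2) * (n + m + 1) ^ (n + 1 ∸ k)))
    ×
    ((n : ℕ) → 1 ≤ n → HasExactlyRegions (Shi n) ((n + 1) ^ (n ∸ 1)))
theorem4p1 = deformation , original
  where
  deformation : (n m k : ℕ) → 1 ≤ n → 2 ≤ k → k ≤ n + 1 →
    HasExactlyRegions (ShiDeformation n m k) ((n + m) ^ (k ∸ 2) * (n + m + 1) ^ (n + 1 ∸ k))
  deformation (suc n) m (suc (suc k)) _ 2≤2+k (s≤s k<n+1) =
    regions (λ i j c → ShiDeformation-proper i j c 2≤2+k)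
      (subst (Reps _)
        (cong₂ _*_ (cong (_^ k) (ℕ.+-suc n m))
          (cong₂ _^_ (trans (cong suc (ℕ.+-suc n m)) (ℕ.+-comm 1 (suc n + m))) (cong (_∸ suc k) (ℕ.+-comm 1 n))))
        -- With `n + 1` coordinates and threshold `k + 2` the second exponent is `n − k`, which is
        -- the `d` of the recursion.
        (Reps-resp (Deform≐ShiDeformation n m k) (Reps-Deform n m k (n ∸ k) (ℕ.m+[n∸m]≡n k≤n))))
    where
    k≤n : k ≤ n
    k≤n = ℕ.≤-pred (subst (suc k ≤_) (ℕ.+-comm n 1) k<n+1)
  deformation (suc n) m (suc zero) _ (s≤s ())
  original : (n : ℕ) → 1 ≤ n → HasExactlyRegions (Shi n) ((n + 1) ^ (n ∸ 1))
  original (suc n) _ = regions Shi-proper (subst (λ t → Reps (Shi (suc n)) (t ^ n)) (ℕ.+-comm 1 (suc n)) (Reps-Shi n))
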